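{- Let $X$ be a finite set of cardinality $n$, let $N=\binom{n}{2}$, and let $\ast\in\mathcal{M}(X)$ be a binary operation with $drank(T_\ast)=d$, $crank(T_\ast)=c$, $arank(T_\ast)=a$. Then the cardinality of the $\mathcal{L}$-class of $\ast$ in $\mathcal{M}(X)$ is exactly $$\mathrm{Surj}(n,d)\sum_{r=a}^{N-c+d}\binom{N}{r}\,\mathrm{Surj}(r,a)\,2^r\left(c^{N-r}+\sum_{k=1}^{c-d}(-1)^k\binom{c-d}{k}(c-k)^{N-r}\right).$$
   Context: $\mathcal{M}(X)=X^{X\times X}$ is the set of all binary operations on $X$, a monoid under $\triangleright$ defined by $a(\circ\triangleright\ast)b=(a\circ b)\ast(b\circ a)$ for all $a,b\in X$, with identity $a\circ_{lz}b=a$. The left Green's relation $\mathcal{L}$: $\ast\,\mathcal{L}\,\star$ iff $\{\circ\triangleright\ast:\circ\in\mathcal{M}(X)\}=\{\circ\triangleright\star:\circ\in\mathcal{M}(X)\}$. The pairmorph transformation of $\ast$ is $T_\ast:X\times X\to X\times X$, $T_\ast(a,b)=(a\ast b,b\ast a)$. Let $\Delta(X)=\{(x,x):x\in X\}$, $im(T_\ast)=T_\ast(X\times X)$, $diag(T_\ast)=T_\ast(\Delta(X))$. Fix a tournament $\omega$ on $X$, i.e. a set $\omega\subseteq X\times X\setminus\Delta(X)$ containing exactly one of $(a,b),(b,a)$ for every pair of distinct $a,b\in X$ (so $|\omega|=N$). Let $acdom(T_\ast)=\{(a,b)\in X\times X: T_\ast(a,b)\notin\Delta(X)\}$, and let $accok_\ast: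 acdom(T_\ast)\cap\omega\to\omega$ be given by $accok_\ast(a,b)=T_\ast(a,b)$ if $T_\ast(a,b)\in\omega$, and $accok_\ast(a,b)=T_\ast(b,a)$ otherwise. Define the commutative image $cim(T_\ast)=im(T_\ast)\cap\Delta(X)$, the anticommutative image $acim(T_\ast)=im(accok_\ast)$, and $drank(T_\ast)=|diag(T_\ast)|$, $crank(T_\ast)=|cim(T_\ast)|$, $arank(T_\ast)=|acim(T_\ast)|$. $\mathrm{Surj}(m,k)$ denotes the number of surjective maps from an $m$-element set onto a $k$-element set, with $\mathrm{Surj}(0,0)=1$. -}

module Defs where

open import Algebra.Bundles using (Monoid)
open import Algebra.Core using (Op₂)
open import Data.Fin.Base using (Fin; finToFun)
open import Data.Fin.Properties using (all?; any?; _≟_)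
open import Data.Integer.Base as ℤ using (ℤ; +_; 0ℤ; -1ℤ)
open import Data.List.Base using (allFin; applyUpTo; filter; foldr; length)
open import Data.Nat.Base using (ℕ; suc; _+_; _∸_; _^_)
open import Data.Nat.Combinatorics using (_C_)
open import Data.Product.Base using (Σ; ∃; _×_; _,_; proj₁; proj₂)
open import Data.Sum.Base using (_⊎_; [_,_]′)
open import Function.Bundles using (Inverse)
open import Function.Definitions using (StrictlySurjective)
open import Level using (Level; _⊔_) renaming (suc to lsuc)
open import Relation.Binary.Bundles using (Setoid)
open import Relation.Binary.Core using (Rel)
open import Relation.Binary.PropositionalEquality
  using (_≡_; _≢_; refl; sym; trans; cong₂; setoid)
import Relation.Binary.Construct.On as On
open import Relation.Nullary.Negation using (¬_)
open import Relation.Unary using (Pred; Decidable; _∈_; _∉_; _∩_; _≐_)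

-- Two members of P are identified when their underlying elements are equal
-- in S; membership proofs are not compared.

subsetSetoid : ∀ {s e p} (S : Setoid s e) → Pred (Setoid.Carrier S) p →
               Setoid (s ⊔ p) e
subsetSetoid S P = On.setoid {B = ∃ P} S proj₁

HasCardinality : ∀ {s e p} (S : Setoid s e) → Pred (Setoid.Carrier S) p →
                 ℕ → Set (s ⊔ e ⊔ p)
HasCardinality S P k = Inverse (subsetSetoid S P) (setoid (Fin k))

Image : ∀ {a b p} {A : Set a} {B : Set b} → (A → B) → Pred A p → Pred B (a ⊔ b ⊔ p)
Image f P y = ∃ λ x → x ∈ P × f x ≡ y

module _ {c e} (M : Monoid c e) where
  open Monoid M

  LeftIdeal : Carrier → Pred Carrier (c ⊔ e)
  LeftIdeal x z = ∃ λ y → z ≈ y ∙ x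

  GreenL : Rel Carrier (c ⊔ e)
  GreenL x y = LeftIdeal x ≐ LeftIdeal y

  LClass : Carrier → Pred Carrier (c ⊔ e)
  LClass x y = GreenL x y

module _ {ℓ} {X : Set ℓ} where

  _▷_ : Op₂ (Op₂ X)
  (_∘_ ▷ _∗_) a b = (a ∘ b) ∗ (b ∘ a)

  lz : Op₂ X
  lz a b = a

-- Operations are compared pointwise, since function extensionality is not
-- available.

𝓜 : ∀ {ℓ} → Set ℓ → Monoid ℓ ℓ
𝓜 X = record
  { Carrier  = Op₂ X
  ; _≈_      = λ _∘_ _∗_ → ∀ a b → a ∘ b ≡ a ∗ b
  ; _∙_      = _▷_
  ; ε        = lz
  ; isMonoid = record
    { isSemigroup = record
      { isMagma = record
        { isEquivalence = record
          { refl  = λ _ _ → refl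
          ; sym   = λ p a b → sym (p a b)
          ; trans = λ p q a b → trans (p a b) (q a b)
          }
        ; ∙-cong = λ {_} {_} {_∗_} p q a b →
            trans (cong₂ _∗_ (p a b) (p b a)) (q _ _)
        }
      ; assoc = λ _ _ _ _ _ → refl
      }
    ; identity = (λ _ _ _ → refl) , (λ _ _ _ → refl)
    }
  }

Δ : ∀ {ℓ} {X : Set ℓ} → Pred (X × X) ℓ
Δ (a , b) = a ≡ b

record IsTournament {ℓ p} {X : Set ℓ} (ω : Pred (X × X) p) : Set (ℓ ⊔ p) where
  field
    offDiagonal : ∀ {ab} → ab ∈ ω → ab ∉ Δ
    exactlyOne  : ∀ {a b} → a ≢ b →
                  ((a , b) ∈ ω × (b , a) ∉ ω) ⊎ ((b , a) ∈ ω × (a , b) ∉ ω)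

record Tournament {ℓ} (X : Set ℓ) p : Set (ℓ ⊔ lsuc p) where
  field
    arcs         : Pred (X × X) p
    isTournament : IsTournament arcs
  open IsTournament isTournament public

module _ {ℓ} {X : Set ℓ} where

  T : Op₂ X → X × X → X × X
  T _∗_ (a , b) = (a ∗ b) , (b ∗ a)

  im : Op₂ X → Pred (X × X) ℓ
  im ∗ q = ∃ λ p → T ∗ p ≡ q

  diag : Op₂ X → Pred (X × X) ℓ
  diag ∗ = Image (T ∗) Δ

  cim : Op₂ X → Pred (X × X) ℓ
  cim ∗ = im ∗ ∩ Δ

  acdom : Op₂ X → Pred (X × X) ℓ
  acdom ∗ p = T ∗ p ∉ Δ

  module _ {p} (ω : Tournament X p) where
    open Tournament ω

    -- For (a , b) ∈ acdom ∗ the entries of T ∗ (a , b) are distinct, and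
    -- T ∗ (b , a) is T ∗ (a , b) with its entries swapped, so exactlyOne
    -- decides whether T ∗ (a , b) is an arc.

    accok : (∗ : Op₂ X) → ∃ (acdom ∗ ∩ arcs) → ∃ arcs
    accok ∗ ((a , b) , ac , _) =
      [ (λ (here  , _) → T ∗ (a , b) , here)
      , (λ (there , _) → T ∗ (b , a) , there)
      ]′ (exactlyOne ac)

    acim : Op₂ X → Pred (X × X) (ℓ ⊔ p)
    acim ∗ q = ∃ λ x → proj₁ (accok ∗ x) ≡ q

    HasArank : Op₂ X → ℕ → Set (ℓ ⊔ p)
    HasArank ∗ = HasCardinality (setoid (X × X)) (acim ∗)

  HasDrank : Op₂ X → ℕ → Set ℓ
  HasDrank ∗ = HasCardinality (setoid (X × X)) (diag ∗)

  HasCrank : Op₂ X → ℕ → Set ℓ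
  HasCrank ∗ = HasCardinality (setoid (X × X)) (cim ∗)

surjective? : ∀ {m k} → Decidable {A = Fin m → Fin k} (StrictlySurjective _≡_)
surjective? f = all? λ y → any? λ x → f x ≟ y

-- finToFun enumerates the k ^ m functions Fin m → Fin k without repetition.

Surj : ℕ → ℕ → ℕ
Surj m k = length (filter (λ i → surjective? (finToFun {k} {m} i)) (allFin (k ^ m)))

-- The sum of f i over lo ≤ i ≤ hi, empty when hi < lo.

∑[_⋯_] : ℕ → ℕ → (ℕ → ℤ) → ℤ
∑[ lo ⋯ hi ] f = foldr ℤ._+_ 0ℤ (applyUpTo (λ i → f (lo + i)) (suc hi ∸ lo))

-- For the ranks of an operation on n points d ≤ c ≤ N + d, and in both sums
-- r ≤ N and k ≤ c, so none of the truncated subtractions truncates. In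
-- particular (N + d) ∸ c is N - c + d, whereas N ∸ c may truncate.

lClassSize : (n d c a : ℕ) → ℤ
lClassSize n d c a =
  + Surj n d ℤ.* ∑[ a ⋯ (N + d) ∸ c ] λ r →
    + (N C r) ℤ.* + Surj r a ℤ.* + (2 ^ r) ℤ.*
      (+ (c ^ (N ∸ r)) ℤ.+
        ∑[ 1 ⋯ c ∸ d ] λ k →
          -1ℤ ℤ.^ k ℤ.* + ((c ∸ d) C k) ℤ.* + ((c ∸ k) ^ (N ∸ r)))
  where
  N : ℕ
  N = n C 2

{-# OPTIONS --safe #-}

-- Since T (y ▷ ∗) = T ∗ ∘ T y, an operation ⋆ is 𝓛-related to ∗ exactly when
-- T ⋆ has the same image as T ∗, both on all of X × X and on the diagonal.
-- Such a ⋆ is a surjection from the n diagonal points onto diag ∗, together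
-- with a word of length N = n C 2 that assigns to each two-element subset of X
-- an element of im ∗. The word has to hit every diagonal pair of im ∗ outside
-- diag ∗, and every arc of im ∗ up to reversal. Removing the first letter of
-- the word gives a recursion for the number of such words. The binomial
-- convolution of the numbers of words with only arc letters and of words with
-- only diagonal letters satisfies the same recursion.

module Submission where

open import Defs
open import Algebra.Bundles using (Monoid)
open import Algebra.Core using (Op₂)
open import Data.Bool.Base using (Bool; true; false; not; _∧_; if_then_else_)
import Data.Bool.Properties as Bool
open import Data.Fin.Base
  using (Fin; zero; suc; _↑ˡ_; _↑ʳ_; combine; remQuot; finToFun; funToFin; splitAt)
open import Data.Fin.Permutation using (↔⇒≡)
open import Data.Fin.Properties
  using ( _≟_; all?; any?; ↑ˡ-injective; ↑ʳ-injective
        ; splitAt-↑ˡ; splitAt-↑ʳ; splitAt⁻¹-↑ˡ; splitAt⁻¹-↑ʳ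
        ; remQuot-combine; combine-remQuot; finToFun-funToFin; funToFin-finToFin)
open import Data.Integer.Base
  using (ℤ; +_; 0ℤ; 1ℤ; -1ℤ; _+_; _-_; _*_) renaming (_^_ to _^ℤ_)
import Data.Integer.Properties as ℤ
open import Data.Integer.Tactic.RingSolver using (solve-∀)
open import Data.List.Base
  using (List; allFin; applyUpTo; filter; foldr; length; lookup; tabulate)
open import Data.List.Membership.Propositional.Properties using (∈-allFin; ∈-filter⁺; ∈-lookup)
import Data.List.Relation.Unary.All as All
open import Data.List.Relation.Unary.All.Properties using (all-filter)
open import Data.List.Relation.Unary.AllPairs using (_∷_)
open import Data.List.Relation.Unary.Any using (index)
open import Data.List.Relation.Unary.Any.Properties using (lookup-index)
open import Data.List.Relation.Unary.Unique.Propositional using (Unique)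
import Data.List.Relation.Unary.Unique.Propositional.Properties as Unique
open import Data.Nat.Base as ℕ
  using (ℕ; zero; suc; pred; _∸_; _^_; _≤_; _<_; s≤s; s<s; z<s)
open import Data.Nat.Combinatorics using (_C_; nCk+nC[k+1]≡[n+1]C[k+1]; k>n⇒nCk≡0; nC1≡n)
import Data.Nat.Properties as ℕ
open import Data.Product.Base as Product using (∃; _×_; _,_; proj₁; proj₂; swap)
open import Data.Product.Properties using (≡-dec)
open import Data.Sum.Base using (_⊎_; inj₁; inj₂; [_,_]′; reduce)
open import Function.Base using (_∘_; case_of_; const; id)
open import Function.Bundles using (Bijection; Inverse; _⇔_; _↔_; mk⇔)
import Function.Construct.Composition as Composition
import Function.Construct.Identity as Identity
import Function.Construct.Symmetry as Symmetry
open import Function.Definitions using (StrictlySurjective)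
open import Function.Properties.Bijection using (Bijection⇒Inverse)
open import Function.Properties.Inverse using (↔⇒↣)
open import Level using (Level)
open import Relation.Binary.Bundles using (Setoid)
open import Relation.Binary.Definitions using (DecidableEquality; _Respects_)
open import Relation.Binary.PropositionalEquality
  using ( _≡_; _≢_; _≗_; refl; sym; trans; cong; cong₂; subst; setoid; _→-setoid_
        ; module ≡-Reasoning)
open import Relation.Nullary.Decidable
  using (Dec; yes; no; does; _→-dec_; map′; via-injection; does-⇔; dec-true; dec-false)
open import Relation.Nullary.Negation using (contradiction)
open import Relation.Unary using (Pred; Decidable; _∈_; _∉_; _⊆_)
open import Algebra.Properties.Semiring.Sum ℤ.+-*-semiring
  using (sum; sum-cong-≗; *-distribˡ-sum)

open ≡-Reasoning

-- `T y` ranges over the self-maps of `X × X` that commute with `swap`. Such a map sends diagonal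
-- pairs to diagonal pairs and is otherwise free on one representative of each orbit of `swap`. So
-- left multiples are liftings: `⋆` is `y ▷ ∗` when `T ⋆` lifts through `T ∗`. An edge may be lifted
-- to any preimage, but a diagonal point needs a preimage on the diagonal, which is why two images
-- have to agree. The word count avoids a sieve on sets of words. The state of the recursion is the
-- set of classes still to be hit, and only its numbers of diagonal and of arc classes matter. It is
-- enough that the alternating sum `hit` obeys the first-letter recursion, and this is algebra
-- starting from `hit-avoid`. An arc class has two letters; this doubling is the origin of `2 ^ r`.

private variable
  ℓ p s e ℓ₁ ℓ₂ : Level
  A : Set ℓ

-- Binomial convolution

interchange : ∀ a b c d → a + b + (c + d) ≡ (a + c) + (b + d)
interchange = solve-∀

sumBelow : (ℕ → ℤ) → ℕ → ℤ
sumBelow f m = foldr _+_ 0ℤ (applyUpTo f m)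

sumBelow-cong : ∀ {f g : ℕ → ℤ} m → (∀ i → i < m → f i ≡ g i) → sumBelow f m ≡ sumBelow g m
sumBelow-cong zero    eq = refl
sumBelow-cong (suc m) eq = cong₂ _+_ (eq 0 z<s) (sumBelow-cong m λ i i<m → eq (suc i) (s<s i<m))

sumBelow-zero : ∀ {f : ℕ → ℤ} m → (∀ i → i < m → f i ≡ 0ℤ) → sumBelow f m ≡ 0ℤ
sumBelow-zero zero    eq = refl
sumBelow-zero (suc m) eq = cong₂ _+_ (eq 0 z<s) (sumBelow-zero m λ i i<m → eq (suc i) (s<s i<m))

sumBelow-distrib-+ : ∀ (f g : ℕ → ℤ) m → sumBelow (λ i → f i + g i) m ≡ sumBelow f m + sumBelow g m
sumBelow-distrib-+ f g zero    = refl
sumBelow-distrib-+ f g (suc m) = begin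
  f 0 + g 0 + sumBelow (λ i → f (suc i) + g (suc i)) m
    ≡⟨ cong (_+_ (f 0 + g 0)) (sumBelow-distrib-+ (f ∘ suc) (g ∘ suc) m) ⟩
  f 0 + g 0 + (sumBelow (f ∘ suc) m + sumBelow (g ∘ suc) m)
    ≡⟨ interchange (f 0) (g 0) _ _ ⟩
  (f 0 + sumBelow (f ∘ suc) m) + (g 0 + sumBelow (g ∘ suc) m) ∎

sumBelow-split : ∀ (f : ℕ → ℤ) m n →
                 sumBelow f (m ℕ.+ n) ≡ sumBelow f m + sumBelow (λ i → f (m ℕ.+ i)) n
sumBelow-split f zero    n = sym (ℤ.+-identityˡ _)
sumBelow-split f (suc m) n =
  trans (cong (_+_ (f 0)) (sumBelow-split (f ∘ suc) m n)) (sym (ℤ.+-assoc (f 0) _ _))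

sumBelow-last : ∀ (f : ℕ → ℤ) m → f m ≡ 0ℤ → sumBelow f (suc m) ≡ sumBelow f m
sumBelow-last f zero    eq = cong (_+ 0ℤ) eq
sumBelow-last f (suc m) eq = cong (_+_ (f 0)) (sumBelow-last (f ∘ suc) m eq)

∑-restrict : ∀ (f : ℕ → ℤ) lo hi m → hi ≤ m →
             (∀ i → i < lo → f i ≡ 0ℤ) → (∀ i → i ≤ m → hi < i → f i ≡ 0ℤ) →
             sumBelow f (suc m) ≡ ∑[ lo ⋯ hi ] f
∑-restrict f lo hi m hi≤m low high with ℕ.≤-total lo (suc hi)
... | inj₁ lo≤hi+1 = begin
  sumBelow f (suc m)                          ≡⟨ cong (sumBelow f) (sym (ℕ.m+[n∸m]≡n (s≤s hi≤m))) ⟩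
  sumBelow f (suc hi ℕ.+ (m ∸ hi))            ≡⟨ sumBelow-split f (suc hi) (m ∸ hi) ⟩
  sumBelow f (suc hi) + sumBelow (λ i → f (suc hi ℕ.+ i)) (m ∸ hi)
    ≡⟨ cong (_+_ (sumBelow f (suc hi))) (sumBelow-zero (m ∸ hi) λ i i< →
         high (suc hi ℕ.+ i) (upper i i<) (s≤s (ℕ.m≤m+n hi i))) ⟩
  sumBelow f (suc hi) + 0ℤ                    ≡⟨ ℤ.+-identityʳ _ ⟩
  sumBelow f (suc hi)                         ≡⟨ cong (sumBelow f) (sym (ℕ.m+[n∸m]≡n lo≤hi+1)) ⟩
  sumBelow f (lo ℕ.+ (suc hi ∸ lo))           ≡⟨ sumBelow-split f lo (suc hi ∸ lo) ⟩
  sumBelow f lo + ∑[ lo ⋯ hi ] f              ≡⟨ cong (_+ ∑[ lo ⋯ hi ] f) (sumBelow-zero lo low) ⟩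
  0ℤ + ∑[ lo ⋯ hi ] f                         ≡⟨ ℤ.+-identityˡ _ ⟩
  ∑[ lo ⋯ hi ] f                              ∎
  where
  upper : ∀ i → i < m ∸ hi → suc hi ℕ.+ i ≤ m
  upper i i< = ℕ.≤-trans (ℕ.≤-reflexive (sym (ℕ.+-suc hi i)))
    (ℕ.≤-trans (ℕ.+-monoʳ-≤ hi i<) (ℕ.≤-reflexive (ℕ.m+[n∸m]≡n hi≤m)))
-- The range is empty here, and every index lies below `lo` or above `hi`, so the full sum vanishes
-- too.
... | inj₂ hi+1≤lo = begin
  sumBelow f (suc m)   ≡⟨ sumBelow-zero (suc m) vanish ⟩
  0ℤ                   ≡⟨⟩
  sumBelow (λ i → f (lo ℕ.+ i)) 0
    ≡⟨ cong (sumBelow λ i → f (lo ℕ.+ i)) (sym (ℕ.m≤n⇒m∸n≡0 hi+1≤lo)) ⟩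
  ∑[ lo ⋯ hi ] f ∎
  where
  vanish : ∀ i → i < suc m → f i ≡ 0ℤ
  vanish i (s≤s i≤m) with i ℕ.<? lo
  ... | yes i<lo = low i i<lo
  ... | no  i≮lo = high i i≤m (ℕ.≤-trans hi+1≤lo (ℕ.≮⇒≥ i≮lo))

-- conv n x y = Σ_r C(n,r) x_r y_(n−r); the recursion is Pascal's rule.

conv : ℕ → (ℕ → ℤ) → (ℕ → ℤ) → ℤ
conv zero    x y = x 0 * y 0
conv (suc n) x y = conv n (x ∘ suc) y + conv n x (y ∘ suc)

conv-cong : ∀ n {x x′ y y′} → x ≗ x′ → y ≗ y′ → conv n x y ≡ conv n x′ y′
conv-cong zero    p q = cong₂ _*_ (p 0) (q 0)
conv-cong (suc n) p q = cong₂ _+_ (conv-cong n (p ∘ suc) q) (conv-cong n p (q ∘ suc))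

conv-comm : ∀ n x y → conv n x y ≡ conv n y x
conv-comm zero    x y = ℤ.*-comm (x 0) (y 0)
conv-comm (suc n) x y = begin
  conv n (x ∘ suc) y + conv n x (y ∘ suc)
    ≡⟨ cong₂ _+_ (conv-comm n (x ∘ suc) y) (conv-comm n x (y ∘ suc)) ⟩
  conv n y (x ∘ suc) + conv n (y ∘ suc) x
    ≡⟨ ℤ.+-comm (conv n y (x ∘ suc)) _ ⟩
  conv n (y ∘ suc) x + conv n y (x ∘ suc) ∎

conv-*ˡ : ∀ n k x y → conv n (λ r → k * x r) y ≡ k * conv n x y
conv-*ˡ zero    k x y = ℤ.*-assoc k (x 0) (y 0)
conv-*ˡ (suc n) k x y = begin
  conv n (λ r → k * x (suc r)) y + conv n (λ r → k * x r) (y ∘ suc)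
    ≡⟨ cong₂ _+_ (conv-*ˡ n k (x ∘ suc) y) (conv-*ˡ n k x (y ∘ suc)) ⟩
  k * conv n (x ∘ suc) y + k * conv n x (y ∘ suc)
    ≡⟨ ℤ.*-distribˡ-+ k _ _ ⟨
  k * (conv n (x ∘ suc) y + conv n x (y ∘ suc)) ∎

conv-+ˡ : ∀ n x x′ y → conv n (λ r → x r + x′ r) y ≡ conv n x y + conv n x′ y
conv-+ˡ zero    x x′ y = ℤ.*-distribʳ-+ (y 0) (x 0) (x′ 0)
conv-+ˡ (suc n) x x′ y = begin
  conv n (λ r → x (suc r) + x′ (suc r)) y + conv n (λ r → x r + x′ r) (y ∘ suc)
    ≡⟨ cong₂ _+_ (conv-+ˡ n (x ∘ suc) (x′ ∘ suc) y) (conv-+ˡ n x x′ (y ∘ suc)) ⟩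
  conv n (x ∘ suc) y + conv n (x′ ∘ suc) y + (conv n x (y ∘ suc) + conv n x′ (y ∘ suc))
    ≡⟨ interchange (conv n (x ∘ suc) y) _ _ _ ⟩
  conv n (x ∘ suc) y + conv n x (y ∘ suc) + (conv n (x′ ∘ suc) y + conv n x′ (y ∘ suc)) ∎

conv-zeroˡ : ∀ n y → conv n (λ _ → 0ℤ) y ≡ 0ℤ
conv-zeroˡ n y = conv-*ˡ n 0ℤ (λ _ → 0ℤ) y

conv-sumˡ : ∀ n {k} (x : Fin k → ℕ → ℤ) y →
            sum (λ i → conv n (x i) y) ≡ conv n (λ r → sum λ i → x i r) y
conv-sumˡ n {zero}  x y = sym (conv-zeroˡ n y)
conv-sumˡ n {suc k} x y =
  trans (cong (_+_ (conv n (x zero) y)) (conv-sumˡ n (x ∘ suc) y))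
        (sym (conv-+ˡ n (x zero) (λ r → sum λ i → x (suc i) r) y))

conv-sumʳ : ∀ n {k} x (y : Fin k → ℕ → ℤ) →
            sum (λ i → conv n x (y i)) ≡ conv n x (λ r → sum λ i → y i r)
conv-sumʳ n x y = begin
  sum (λ i → conv n x (y i))        ≡⟨ sum-cong-≗ (λ i → conv-comm n x (y i)) ⟩
  sum (λ i → conv n (y i) x)        ≡⟨ conv-sumˡ n y x ⟩
  conv n (λ r → sum λ i → y i r) x  ≡⟨ conv-comm n _ x ⟩
  conv n x (λ r → sum λ i → y i r)  ∎

-- The two halves of the recursion contribute `n C r` and `n C suc r` to the term with `x (suc r)`,
-- and Pascal's rule adds them. Here the recursive convolution becomes the sum over `r` of the
-- formula.
conv-expand : ∀ n x y → conv n x y ≡ sumBelow (λ r → + (n C r) * x r * y (n ∸ r)) (suc n)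
conv-expand zero    x y = simplify (x 0) (y 0)
  where
  simplify : ∀ a b → a * b ≡ 1ℤ * a * b + 0ℤ
  simplify = solve-∀
conv-expand (suc n) x y = begin
  conv n (x ∘ suc) y + conv n x (y ∘ suc)
    ≡⟨ cong₂ _+_ (conv-expand n (x ∘ suc) y) (conv-expand n x (y ∘ suc)) ⟩
  sumBelow f (suc n) + sumBelow (λ r → + (n C r) * x r * y (suc (n ∸ r))) (suc n)
    -- `suc (n ∸ r)` agrees with `suc n ∸ r` for `r ≤ n`, which the range of the sum supplies.
    ≡⟨ cong (_+_ (sumBelow f (suc n))) (sumBelow-cong (suc n) λ r r<1+n →
         cong (λ s → + (n C r) * x r * y s) (sym (ℕ.+-∸-assoc 1 (ℕ.s≤s⁻¹ r<1+n)))) ⟩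
  sumBelow f (suc n) + sumBelow g (suc n)
    -- The added term carries the factor `n C suc n`, which is 0; it lets `g`, shifted by one, match
    -- the length of the sum of `f`.
    ≡⟨ cong (_+_ (sumBelow f (suc n))) (sym (sumBelow-last g (suc n) g[1+n]≡0)) ⟩
  sumBelow f (suc n) + (g 0 + sumBelow (g ∘ suc) (suc n))
    ≡⟨ rotate (sumBelow f (suc n)) (g 0) _ ⟩
  g 0 + (sumBelow f (suc n) + sumBelow (g ∘ suc) (suc n))
    ≡⟨ cong (_+_ (g 0)) (sym (sumBelow-distrib-+ f (g ∘ suc) (suc n))) ⟩
  g 0 + sumBelow (λ r → f r + g (suc r)) (suc n)
    ≡⟨ cong (_+_ (g 0)) (sumBelow-cong (suc n) λ r _ → pascal r) ⟩
  sumBelow (λ r → + (suc n C r) * x r * y (suc n ∸ r)) (suc (suc n)) ∎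
  where
  f g : ℕ → ℤ
  f r = + (n C r) * x (suc r) * y (n ∸ r)
  g r = + (n C r) * x r * y (suc n ∸ r)
  g[1+n]≡0 : g (suc n) ≡ 0ℤ
  g[1+n]≡0 = cong (λ k → + k * x (suc n) * y (n ∸ n)) (k>n⇒nCk≡0 (ℕ.n<1+n n))
  rotate : ∀ a b c → a + (b + c) ≡ b + (a + c)
  rotate = solve-∀
  factor : ∀ a b c d → a * c * d + b * c * d ≡ (a + b) * c * d
  factor = solve-∀
  pascal : ∀ r → f r + g (suc r) ≡ + (suc n C suc r) * x (suc r) * y (n ∸ r)
  pascal r = begin
    f r + g (suc r)
      ≡⟨ factor (+ (n C r)) (+ (n C suc r)) (x (suc r)) (y (n ∸ r)) ⟩
    + (n C r ℕ.+ n C suc r) * x (suc r) * y (n ∸ r)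
      ≡⟨ cong (λ k → + k * x (suc r) * y (n ∸ r)) (nCk+nC[k+1]≡[n+1]C[k+1] n r) ⟩
    + (suc n C suc r) * x (suc r) * y (n ∸ r) ∎

-- Inclusion-exclusion numbers and their recursion

-- For v ≤ q, hit m q v is the number of words of length m over q letters in
-- which v prescribed letters all occur, by inclusion–exclusion over these v
-- letters. For v > q the truncated q ∸ k makes it meaningless.

alt : ℕ → ℕ → ℕ → ℤ
alt m q k = -1ℤ ^ℤ k * + ((q ∸ k) ^ m)

hit : (m q v : ℕ) → ℤ
hit m q v = conv v (alt m q) (λ _ → 1ℤ)

hit-closed : ∀ m q v →
  hit m q v ≡ + (q ^ m) + ∑[ 1 ⋯ v ] (λ k → -1ℤ ^ℤ k * + (v C k) * + ((q ∸ k) ^ m))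
hit-closed m q v = begin
  hit m q v  ≡⟨ conv-expand v (alt m q) (λ _ → 1ℤ) ⟩
  1ℤ * (1ℤ * + (q ^ m)) * 1ℤ + sumBelow (λ k → + (v C suc k) * alt m q (suc k) * 1ℤ) v
    ≡⟨ cong₂ _+_ (first (+ (q ^ m))) (sumBelow-cong v λ k _ →
         shuffle (+ (v C suc k)) (-1ℤ ^ℤ suc k) (+ ((q ∸ suc k) ^ m))) ⟩
  + (q ^ m) + ∑[ 1 ⋯ v ] (λ k → -1ℤ ^ℤ k * + (v C k) * + ((q ∸ k) ^ m)) ∎
  where
  first : ∀ a → 1ℤ * (1ℤ * a) * 1ℤ ≡ a
  first = solve-∀
  shuffle : ∀ a b c → a * (b * c) * 1ℤ ≡ b * a * c
  shuffle = solve-∀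

-- Of the words that hit `v` letters, those that also hit one more are all but the ones avoiding it,
-- and avoiding it leaves `q` letters. For the alternating sums, `suc q ∸ suc k` reduces to `q ∸ k`,
-- so shifting `alt` only changes the sign.
hit-avoid : ∀ m q v → hit m (suc q) (suc v) ≡ hit m (suc q) v - hit m q v
hit-avoid m q v = begin
  conv v (alt m (suc q) ∘ suc) (λ _ → 1ℤ) + hit m (suc q) v
    ≡⟨ cong (_+ hit m (suc q) v) (conv-cong v {y = λ _ → 1ℤ}
         (λ k → ℤ.*-assoc -1ℤ (-1ℤ ^ℤ k) _) (λ _ → refl)) ⟩
  conv v (λ k → -1ℤ * alt m q k) (λ _ → 1ℤ) + hit m (suc q) v
    ≡⟨ cong (_+ hit m (suc q) v) (conv-*ˡ v -1ℤ (alt m q) (λ _ → 1ℤ)) ⟩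
  -1ℤ * hit m q v + hit m (suc q) v
    ≡⟨ rearrange (hit m q v) (hit m (suc q) v) ⟩
  hit m (suc q) v - hit m q v ∎
  where
  rearrange : ∀ a b → -1ℤ * a + b ≡ b - a
  rearrange = solve-∀

-- The first-letter recursion: one of the `v` prescribed letters leaves `v - 1` to be hit, one of
-- the `w` others leaves all `v`. The form `v + w` keeps `v ≤ q`; at `v = 0` the value of `pred`
-- does not matter, since its coefficient is 0.
hit-step : ∀ m v w → hit (suc m) (v ℕ.+ w) v ≡
                     + v * hit m (v ℕ.+ w) (pred v) + + w * hit m (v ℕ.+ w) v
hit-step m zero    w = begin
  1ℤ * + (w ℕ.* w ^ m) * 1ℤ       ≡⟨ cong (λ z → 1ℤ * z * 1ℤ) (ℤ.pos-* w (w ^ m)) ⟩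
  1ℤ * (+ w * + (w ^ m)) * 1ℤ     ≡⟨ rearrange (+ w) (+ (w ^ m)) (hit m w 0) ⟩
  0ℤ * hit m w 0 + + w * (1ℤ * + (w ^ m) * 1ℤ) ∎
  where
  rearrange : ∀ a b c → 1ℤ * (a * b) * 1ℤ ≡ 0ℤ * c + a * (1ℤ * b * 1ℤ)
  rearrange = solve-∀
hit-step m (suc v) w = begin
  hit (suc m) (suc q) (suc v)
    ≡⟨ hit-avoid (suc m) q v ⟩
  hit (suc m) (suc q) v - hit (suc m) q v
    -- The induction hypothesis enters for two alphabets: `suc w` other letters make `suc q` in all,
    -- and `w` make `q`.
    ≡⟨ cong₂ _-_ (subst (λ p → hit (suc m) p v ≡ + v * hit m p (pred v) + + suc w * hit m p v)
                        (ℕ.+-suc v w) (hit-step m v (suc w)))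
                 (hit-step m v w) ⟩
  + v * hit m (suc q) (pred v) + (1ℤ + + w) * hit m (suc q) v
    - (+ v * hit m q (pred v) + + w * hit m q v)
    ≡⟨ regroup (+ v * hit m (suc q) (pred v)) (+ w) (hit m (suc q) v)
               (+ v * hit m q (pred v)) (hit m q v) ⟩
  (+ v * hit m (suc q) (pred v) - + v * hit m q (pred v))
    + (hit m (suc q) v + + w * (hit m (suc q) v - hit m q v))
    ≡⟨ cong₂ (λ s t → s + (hit m (suc q) v + + w * t)) (collect v) (sym (hit-avoid m q v)) ⟩
  + v * hit m (suc q) v + (hit m (suc q) v + + w * hit m (suc q) (suc v))
    ≡⟨ regroup′ (+ v) (hit m (suc q) v) (+ w * hit m (suc q) (suc v)) ⟩
  (1ℤ + + v) * hit m (suc q) v + + w * hit m (suc q) (suc v) ∎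
  where
  q = v ℕ.+ w
  regroup : ∀ a b c d e → a + (1ℤ + b) * c - (d + b * e) ≡ (a - d) + (c + b * (c - e))
  regroup = solve-∀
  regroup′ : ∀ a b c → a * b + (b + c) ≡ (1ℤ + a) * b + c
  regroup′ = solve-∀
  cancel : ∀ a b → 0ℤ * a - 0ℤ * b ≡ 0ℤ
  cancel = solve-∀
  distrib : ∀ a b c → a * b - a * c ≡ a * (b - c)
  distrib = solve-∀
  collect : ∀ u → + u * hit m (suc q) (pred u) - + u * hit m q (pred u) ≡ + u * hit m (suc q) u
  collect zero    = cancel (hit m (suc q) 0) (hit m q 0)
  collect (suc u) = trans (distrib (+ suc u) (hit m (suc q) u) (hit m q u))
                          (cong (+ suc u *_) (sym (hit-avoid m q u)))

hit-zero : ∀ q v → hit 0 q (suc v) ≡ 0ℤ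
hit-zero q v = begin
  -- Every zeroth power is 1, so `hit 0 q v` is definitionally the same for all `q`; the difference
  -- is that of two equal terms.
  hit 0 q (suc v)              ≡⟨ hit-avoid 0 q v ⟩
  hit 0 (suc q) v - hit 0 q v  ≡⟨ ℤ.+-inverseʳ (hit 0 q v) ⟩
  0ℤ ∎

-- No word of length `m` has room for `v` different letters; in the algebra, both terms of
-- `hit-step` are short again. Both ends of the range of `r` in the formula come from this.
hit-short : ∀ m v w → m < v → hit m (v ℕ.+ w) v ≡ 0ℤ
hit-short zero    (suc v) w _         = hit-zero (suc v ℕ.+ w) v
hit-short (suc m) (suc v) w (s≤s m<v) = begin
  hit (suc m) (suc v ℕ.+ w) (suc v)
    ≡⟨ hit-step m (suc v) w ⟩
  + suc v * hit m (suc v ℕ.+ w) v + + w * hit m (suc v ℕ.+ w) (suc v)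
    ≡⟨ cong₂ (λ s t → + suc v * s + + w * t)
         (subst (λ p → hit m p v ≡ 0ℤ) (ℕ.+-suc v w) (hit-short m v (suc w) m<v))
         (hit-short m (suc v) w (ℕ.m<n⇒m<1+n m<v)) ⟩
  + suc v * 0ℤ + + w * 0ℤ
    ≡⟨ vanish (+ suc v) (+ w) ⟩
  0ℤ ∎
  where
  vanish : ∀ a b → a * 0ℤ + b * 0ℤ ≡ 0ℤ
  vanish = solve-∀

-- Outside a ≤ r ≤ N − c + d one of the two factors counts no words.

conv-hit : ∀ N a c d → d ≤ c →
  conv N (λ r → + (2 ^ r) * hit r a a) (λ s → hit s c (c ∸ d)) ≡
  ∑[ a ⋯ (N ℕ.+ d) ∸ c ] λ r →
    + (N C r) * hit r a a * + (2 ^ r) * hit (N ∸ r) c (c ∸ d)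
conv-hit N a c d d≤c = begin
  conv N (λ r → + (2 ^ r) * hit r a a) (λ s → hit s c (c ∸ d))
    ≡⟨ conv-expand N _ _ ⟩
  sumBelow (λ r → + (N C r) * (+ (2 ^ r) * hit r a a) * hit (N ∸ r) c (c ∸ d)) (suc N)
    ≡⟨ sumBelow-cong (suc N) (λ r _ →
         shuffle (+ (N C r)) (+ (2 ^ r)) (hit r a a) (hit (N ∸ r) c (c ∸ d))) ⟩
  sumBelow term (suc N)
    ≡⟨ ∑-restrict term a ((N ℕ.+ d) ∸ c) N hi≤N low high ⟩
  ∑[ a ⋯ (N ℕ.+ d) ∸ c ] term ∎
  where
  term : ℕ → ℤ
  term r = + (N C r) * hit r a a * + (2 ^ r) * hit (N ∸ r) c (c ∸ d)
  shuffle : ∀ x y z w → x * (y * z) * w ≡ x * z * y * w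
  shuffle = solve-∀
  hi≤N : (N ℕ.+ d) ∸ c ≤ N
  hi≤N = ℕ.≤-trans (ℕ.∸-monoʳ-≤ (N ℕ.+ d) d≤c) (ℕ.≤-reflexive (ℕ.m+n∸n≡m N d))
  zeroʳ³ : ∀ x y z → x * 0ℤ * y * z ≡ 0ℤ
  zeroʳ³ = solve-∀
  low : ∀ r → r < a → term r ≡ 0ℤ
  low r r<a = trans
    (cong (λ h → + (N C r) * h * + (2 ^ r) * hit (N ∸ r) c (c ∸ d))
      (subst (λ p → hit r p a ≡ 0ℤ) (ℕ.+-identityʳ a) (hit-short r a 0 r<a)))
    (zeroʳ³ (+ (N C r)) (+ (2 ^ r)) (hit (N ∸ r) c (c ∸ d)))
  high : ∀ r → r ≤ N → (N ℕ.+ d) ∸ c < r → term r ≡ 0ℤ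
  high r r≤N hi<r = trans
    (cong (_*_ (+ (N C r) * hit r a a * + (2 ^ r)))
      (subst (λ p → hit (N ∸ r) p (c ∸ d) ≡ 0ℤ) (ℕ.m∸n+n≡m d≤c)
             (hit-short (N ∸ r) (c ∸ d) d N∸r<c∸d)))
    (ℤ.*-zeroʳ (+ (N C r) * hit r a a * + (2 ^ r)))
    where
    -- Safe even where `(N + d) ∸ c` truncates, because `N + d ≤ c + ((N + d) ∸ c)` always holds.
    N+d<c+r : N ℕ.+ d < c ℕ.+ r
    N+d<c+r = ℕ.≤-<-trans (ℕ.m≤n+m∸n (N ℕ.+ d) c) (ℕ.+-monoʳ-< c hi<r)
    regroup : N ∸ r ℕ.+ d ℕ.+ r ≡ N ℕ.+ d
    regroup = trans (trans (ℕ.+-assoc (N ∸ r) d r)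
                           (trans (cong (N ∸ r ℕ.+_) (ℕ.+-comm d r)) (sym (ℕ.+-assoc (N ∸ r) r d))))
                    (cong (ℕ._+ d) (ℕ.m∸n+n≡m r≤N))
    N∸r<c∸d : N ∸ r < c ∸ d
    N∸r<c∸d = ℕ.m+n≤o⇒m≤o∸n (suc (N ∸ r))
      (ℕ.+-cancelʳ-≤ r _ _ (subst (_< c ℕ.+ r) (sym regroup) N+d<c+r))

-- Counting by decidable predicates

count : ∀ {k} {P : Pred (Fin k) p} → Decidable P → ℕ
count P? = length (filter P? (allFin _))

lookup-injective : ∀ {A : Set s} {xs : List A} → Unique xs →
                   ∀ i j → lookup xs i ≡ lookup xs j → i ≡ j
lookup-injective (x∉xs ∷ xs!) zero    zero    eq = refl
lookup-injective (x∉xs ∷ xs!) zero    (suc j) eq = contradiction eq (All.lookup x∉xs (∈-lookup j))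
lookup-injective (x∉xs ∷ xs!) (suc i) zero    eq =
  contradiction (sym eq) (All.lookup x∉xs (∈-lookup i))
lookup-injective (x∉xs ∷ xs!) (suc i) (suc j) eq = cong suc (lookup-injective xs! i j eq)

-- `P?` tests the representative `from (to x)`, which is only `≈` to `x`; `resp` carries membership
-- from one to the other. Different positions in the filtered list give inequivalent members because
-- `allFin k` has no repetitions.
count-card : ∀ {k} (S : Setoid s e) {P : Pred (Setoid.Carrier S) p} → P Respects Setoid._≈_ S →
             (enum : Inverse S (setoid (Fin k))) (P? : Decidable (P ∘ Inverse.from enum)) →
             HasCardinality S P (count P?)
count-card {k = k} S {P} resp enum P? = Symmetry.inverse (Bijection⇒Inverse bijection)
  where
  open Inverse enum
  open Setoid S using () renaming (refl to ≈-refl; sym to ≈-sym; trans to ≈-trans)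
  xs = filter P? (allFin k)
  member : Fin (length xs) → ∃ P
  member i = from (lookup xs i) , All.lookup (all-filter P? (allFin k)) (∈-lookup i)
  from-to : ∀ x → Setoid._≈_ S (from (to x)) x
  from-to x = strictlyInverseʳ x
  bijection : Bijection (setoid (Fin (length xs))) (subsetSetoid S P)
  bijection = record
    { to = member
    ; cong = λ { refl → ≈-refl }
    ; bijective =
        (λ {i} {j} eq → lookup-injective (Unique.filter⁺ P? (Unique.allFin⁺ k)) i j
          (trans (sym (strictlyInverseˡ _)) (trans (to-cong eq) (strictlyInverseˡ _))))
      , λ (x , px) →
          let x∈xs = ∈-filter⁺ P? (∈-allFin (to x)) (resp (≈-sym (from-to x)) px) in
          index x∈xs , λ { refl → ≈-trans (from-cong (sym (lookup-index x∈xs))) (from-to x) }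
    }

-- The Iverson bracket: counts become sums over `Fin`, which can be regrouped by the first letter.
⟦_⟧ : {P : Set p} → Dec P → ℤ
⟦ d ⟧ = if does d then 1ℤ else 0ℤ

⟦⟧-cong : {P : Set ℓ₁} {Q : Set ℓ₂} → P ⇔ Q → (p? : Dec P) (q? : Dec Q) → ⟦ p? ⟧ ≡ ⟦ q? ⟧
⟦⟧-cong P⇔Q p? q? = cong (if_then 1ℤ else 0ℤ) (does-⇔ P⇔Q p? q?)

+count : ∀ {k} {P : Pred (Fin k) p} (P? : Decidable P) → + count P? ≡ sum (λ i → ⟦ P? i ⟧)
+count {k = k} P? = go id
  where
  go : ∀ {n} (f : Fin n → Fin k) → + length (filter P? (tabulate f)) ≡ sum (λ i → ⟦ P? (f i) ⟧)
  go {zero}  f = refl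
  go {suc n} f with does (P? (f zero))
  ... | true  = cong (_+_ 1ℤ) (go (f ∘ suc))
  ... | false = trans (go (f ∘ suc)) (sym (ℤ.+-identityˡ _))

count-cong : ∀ {k} {P : Pred (Fin k) ℓ₁} {Q : Pred (Fin k) ℓ₂}
             (P? : Decidable P) (Q? : Decidable Q) → (∀ i → P i ⇔ Q i) → count P? ≡ count Q?
count-cong P? Q? P⇔Q = ℤ.+-injective (begin
  + count P?              ≡⟨ +count P? ⟩
  sum (λ i → ⟦ P? i ⟧)    ≡⟨ sum-cong-≗ (λ i → ⟦⟧-cong (P⇔Q i) (P? i) (Q? i)) ⟩
  sum (λ i → ⟦ Q? i ⟧)    ≡⟨ +count Q? ⟨
  + count Q? ∎)

sum-↑ : ∀ m {n} (f : Fin (m ℕ.+ n) → ℤ) →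
        sum f ≡ sum (λ i → f (i ↑ˡ n)) + sum (λ j → f (m ↑ʳ j))
sum-↑ zero    f = sym (ℤ.+-identityˡ (sum f))
sum-↑ (suc m) f = trans (cong (_+_ (f zero)) (sum-↑ m (f ∘ suc))) (sym (ℤ.+-assoc (f zero) _ _))

sum-combine : ∀ m {n} (f : Fin (m ℕ.* n) → ℤ) →
              sum f ≡ sum (λ (i : Fin m) → sum λ (j : Fin n) → f (combine i j))
sum-combine zero        f = refl
sum-combine (suc m) {n} f =
  trans (sum-↑ n f) (cong (_+_ (sum λ j → f (j ↑ˡ m ℕ.* n))) (sum-combine m (λ i → f (n ↑ʳ i))))

-- Sizes of Boolean subsets

size : ∀ {s} → (Fin s → Bool) → ℕ
size {zero}  U = 0
size {suc s} U = (if U zero then 1 else 0) ℕ.+ size (U ∘ suc)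

size-cong : ∀ {s} {U V : Fin s → Bool} → U ≗ V → size U ≡ size V
size-cong {zero}  eq = refl
size-cong {suc s} eq = cong₂ (λ b k → (if b then 1 else 0) ℕ.+ k) (eq zero) (size-cong (eq ∘ suc))

size-complement : ∀ {s} (U : Fin s → Bool) → size U ℕ.+ size (not ∘ U) ≡ s
size-complement {zero}  U = refl
size-complement {suc s} U with U zero
... | true  = cong suc (size-complement (U ∘ suc))
... | false = trans (ℕ.+-suc (size (U ∘ suc)) _) (cong suc (size-complement (U ∘ suc)))

size-full : ∀ s → size {s} (λ _ → true) ≡ s
size-full zero    = refl
size-full (suc s) = cong suc (size-full s)

size-count : ∀ {s} {P : Pred (Fin s) p} (P? : Decidable P) → count P? ≡ size (does ∘ P?)
size-count P? = ℤ.+-injective (trans (+count P?) (go (does ∘ P?)))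
  where
  go : ∀ {s} (U : Fin s → Bool) → sum (λ i → if U i then 1ℤ else 0ℤ) ≡ + size U
  go {zero}  U = refl
  go {suc s} U with U zero
  ... | true  = cong (_+_ 1ℤ) (go (U ∘ suc))
  ... | false = trans (ℤ.+-identityˡ _) (go (U ∘ suc))

size≡0⇒false : ∀ {s} (U : Fin s → Bool) → size U ≡ 0 → ∀ t → U t ≡ false
size≡0⇒false {suc s} U eq t with U zero in U0
size≡0⇒false {suc s} U eq zero    | false = U0
size≡0⇒false {suc s} U eq (suc t) | false = size≡0⇒false (U ∘ suc) eq t

size≡suc⇒true : ∀ {s v} (U : Fin s → Bool) → size U ≡ suc v → ∃ λ t → U t ≡ true
size≡suc⇒true {suc s} U eq with U zero in U0
... | true  = zero , U0
... | false with t , Ut ← size≡suc⇒true (U ∘ suc) eq = suc t , Ut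

sum-if : ∀ {s} (U : Fin s → Bool) x y →
         sum (λ i → if U i then x else y) ≡ + size U * x + + size (not ∘ U) * y
sum-if {zero}  U x y = refl
sum-if {suc s} U x y with U zero
... | true  = trans (cong (_+_ x) (sum-if (U ∘ suc) x y))
                  (regroup x y (+ size (U ∘ suc)) (+ size (not ∘ U ∘ suc)))
  where
  regroup : ∀ x y m n → x + (m * x + n * y) ≡ (1ℤ + m) * x + n * y
  regroup = solve-∀
... | false = trans (cong (_+_ y) (sum-if (U ∘ suc) x y))
                  (regroup x y (+ size (U ∘ suc)) (+ size (not ∘ U ∘ suc)))
  where
  regroup : ∀ x y m n → y + (m * x + n * y) ≡ m * x + (1ℤ + n) * y
  regroup = solve-∀

remove : ∀ {s} → (Fin s → Bool) → Fin s → Fin s → Bool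
remove U i t = U t ∧ not (does (i ≟ t))

size-remove-∈ : ∀ {s} (U : Fin s → Bool) i → U i ≡ true → suc (size (remove U i)) ≡ size U
size-remove-∈ U zero    eq with true ← U zero =
  cong suc (size-cong λ t → Bool.∧-identityʳ (U (suc t)))
size-remove-∈ U (suc i) eq with U zero
... | true  = cong suc (size-remove-∈ (U ∘ suc) i eq)
... | false = size-remove-∈ (U ∘ suc) i eq

size-remove-∉ : ∀ {s} (U : Fin s → Bool) i → U i ≡ false → size (remove U i) ≡ size U
size-remove-∉ U zero    eq with false ← U zero =
  size-cong λ t → Bool.∧-identityʳ (U (suc t))
size-remove-∉ U (suc i) eq with U zero
... | true  = cong suc (size-remove-∉ (U ∘ suc) i eq)
... | false = size-remove-∉ (U ∘ suc) i eq

-- `hit-step` read as a sum over the first letter: a letter in `U` lowers the size by one, any other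
-- keeps it.
hit-remove : ∀ m {s} (U : Fin s → Bool) →
             sum (λ i → hit m s (size (remove U i))) ≡ hit (suc m) s (size U)
hit-remove m {s} U = begin
  sum (λ i → hit m s (size (remove U i)))
    ≡⟨ sum-cong-≗ split ⟩
  sum (λ i → if U i then hit m s (pred (size U)) else hit m s (size U))
    ≡⟨ sum-if U _ _ ⟩
  + size U * hit m s (pred (size U)) + + size (not ∘ U) * hit m s (size U)
    -- The alphabet splits into `U` and its complement, which gives the form `v + w` of `hit-step`.
    ≡⟨ subst (λ q → hit (suc m) q (size U) ≡
                    + size U * hit m q (pred (size U)) + + size (not ∘ U) * hit m q (size U))
             (size-complement U) (hit-step m (size U) (size (not ∘ U))) ⟨
  hit (suc m) s (size U) ∎
  where
  split : ∀ i → hit m s (size (remove U i)) ≡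
                (if U i then hit m s (pred (size U)) else hit m s (size U))
  split i with U i in Ui
  ... | true  = cong (hit m s ∘ pred) (size-remove-∈ U i Ui)
  ... | false = cong (hit m s) (size-remove-∉ U i Ui)

-- Words that cover a set of classes

module _ {q s} (κ : Fin q → Fin s) where

  -- `κ` gives the class of a letter, and `U` is the set of classes still to be hit. `κ = id` yields
  -- ordinary words; `κ = fold c a` makes an arc and its reversal equally good.
  Covers : (Fin s → Bool) → ∀ {m} → Pred (Fin m → Fin q) _
  Covers U w = ∀ t → U t ≡ true → ∃ λ j → κ (w j) ≡ t

  covers? : ∀ U {m} → Decidable (Covers U {m})
  covers? U w = all? λ t → (U t Bool.≟ true) →-dec any? λ j → κ (w j) ≟ t

  Covers-resp : ∀ {U m} → Covers U {m} Respects _≗_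
  Covers-resp v≗w cov t Ut with j , eq ← cov t Ut = j , trans (cong κ (sym (v≗w j))) eq

  -- The first letter settles its own class, so the rest of the word owes exactly the other classes
  -- of `U`.
  Covers-uncons : ∀ U {m} (w : Fin (suc m) → Fin q) →
                  Covers U w ⇔ Covers (remove U (κ (w zero))) (w ∘ suc)
  Covers-uncons U w = mk⇔ to from
    where
    to : Covers U w → Covers (remove U (κ (w zero))) (w ∘ suc)
    to cov t eq with U t in Ut | κ (w zero) ≟ t
    to cov t () | true  | yes _
    to cov t () | false | _
    ... | true | no κw₀≢t with cov t Ut
    ... | zero  , κw₀≡t = contradiction κw₀≡t κw₀≢t
    ... | suc j , κwⱼ≡t = j , κwⱼ≡t
    from : Covers (remove U (κ (w zero))) (w ∘ suc) → Covers U w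
    from cov t Ut with κ (w zero) ≟ t in eq
    ... | yes κw₀≡t = zero , κw₀≡t
    ... | no  _     with j , κwⱼ≡t ← cov t (cong₂ (λ b d → b ∧ not (does d)) Ut eq) = suc j , κwⱼ≡t

  covering : ℕ → (Fin s → Bool) → ℕ
  covering m U = count λ i → covers? U (finToFun {q} {m} i)

  covering-zero-full : ∀ U → size U ≡ 0 → + covering 0 U ≡ 1ℤ
  covering-zero-full U eq = trans (+count (λ i → covers? U (finToFun {q} {0} i)))
    (cong (λ b → (if b then 1ℤ else 0ℤ) + 0ℤ) (dec-true (covers? U (finToFun {q} {0} zero))
      λ t Ut → case trans (sym Ut) (size≡0⇒false U eq t) of λ ()))

  covering-zero-empty : ∀ U {v} → size U ≡ suc v → + covering 0 U ≡ 0ℤ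
  covering-zero-empty U eq = trans (+count (λ i → covers? U (finToFun {q} {0} i)))
    (cong (λ b → (if b then 1ℤ else 0ℤ) + 0ℤ) (dec-false (covers? U (finToFun {q} {0} zero))
      λ cov → let t , Ut = size≡suc⇒true U eq in case proj₁ (cov t Ut) of λ ()))

  covering-suc : ∀ m U → + covering (suc m) U ≡ sum λ l → + covering m (remove U (κ l))
  covering-suc m U = begin
    + covering (suc m) U
      ≡⟨ +count (λ i → covers? U (finToFun {q} {suc m} i)) ⟩
    sum (λ i → ⟦ covers? U (finToFun {q} {suc m} i) ⟧)
      ≡⟨ sum-combine q (λ i → ⟦ covers? U (finToFun {q} {suc m} i) ⟧) ⟩
    sum (λ (l : Fin q) → sum λ (i : Fin (q ^ m)) →
           ⟦ covers? U (finToFun {q} {suc m} (combine l i)) ⟧)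
      -- `combine l i` is the index of the word with first letter `l` and remaining word `i`;
      -- `finToFun` reads both off with `remQuot`.
      ≡⟨ sum-cong-≗ (λ l → sum-cong-≗ λ i → trans
           (⟦⟧-cong (Covers-uncons U (finToFun {q} {suc m} (combine l i)))
                    (covers? U _) (covers? _ _))
           (cong (λ (l′ , i′) → ⟦ covers? (remove U (κ l′)) (finToFun {q} {m} i′) ⟧)
                 (remQuot-combine {q} l i))) ⟩
    sum (λ (l : Fin q) → sum λ (i : Fin (q ^ m)) →
           ⟦ covers? (remove U (κ l)) (finToFun {q} {m} i) ⟧)
      ≡⟨ sum-cong-≗ (λ l → +count (λ i → covers? (remove U (κ l)) (finToFun {q} {m} i))) ⟨
    sum (λ l → + covering m (remove U (κ l))) ∎

-- Both sides obey the same recursion in `m`. It needs every `U`, since each letter shrinks the set;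
-- surjections are the case where `U` is everything.
covering-id : ∀ m {s} (U : Fin s → Bool) → + covering id m U ≡ hit m s (size U)
covering-id zero {s} U with size U in eq
... | zero  = covering-zero-full id U eq
... | suc v = trans (covering-zero-empty id U eq) (sym (hit-zero s v))
covering-id (suc m) {s} U = begin
  + covering id (suc m) U                   ≡⟨ covering-suc id m U ⟩
  sum (λ l → + covering id m (remove U l))  ≡⟨ sum-cong-≗ (λ l → covering-id m (remove U l)) ⟩
  sum (λ l → hit m s (size (remove U l)))   ≡⟨ hit-remove m U ⟩
  hit (suc m) s (size U) ∎

+Surj : ∀ m k → + Surj m k ≡ hit m k k
+Surj m k = begin
  + Surj m k
    ≡⟨ cong +_ (count-cong (λ i → surjective? (finToFun {k} {m} i))
                           (λ i → covers? id (λ _ → true) (finToFun {k} {m} i))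
                           (λ _ → mk⇔ (λ surj t _ → surj t) (λ cov t → cov t refl))) ⟩
  + covering id m (λ (_ : Fin k) → true)
    ≡⟨ covering-id m (λ _ → true) ⟩
  hit m k (size {k} (λ _ → true))
    ≡⟨ cong (hit m k) (size-full k) ⟩
  hit m k k ∎

-- Words in diagonal and arc letters

-- The letters of Fin (c + (a + a)) are c diagonal pairs, a arcs and the a
-- reversed arcs; fold identifies each arc with its reversal.

module _ (c a : ℕ) where

  fold : Fin (c ℕ.+ (a ℕ.+ a)) → Fin (c ℕ.+ a)
  fold l = [ _↑ˡ a , (λ j → c ↑ʳ reduce (splitAt a j)) ]′ (splitAt c l)

  fold-diagonal : ∀ i → fold (i ↑ˡ (a ℕ.+ a)) ≡ i ↑ˡ a
  fold-diagonal i rewrite splitAt-↑ˡ c i (a ℕ.+ a) = refl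

  fold-arc : ∀ i → fold (c ↑ʳ (i ↑ˡ a)) ≡ c ↑ʳ i
  fold-arc i rewrite splitAt-↑ʳ c (a ℕ.+ a) (i ↑ˡ a) | splitAt-↑ˡ a i a = refl

  fold-reversed : ∀ i → fold (c ↑ʳ (a ↑ʳ i)) ≡ c ↑ʳ i
  fold-reversed i rewrite splitAt-↑ʳ c (a ℕ.+ a) (a ↑ʳ i) | splitAt-↑ʳ a a i = refl

↑ˡ≢↑ʳ : ∀ {m n} (i : Fin m) (j : Fin n) → i ↑ˡ n ≢ m ↑ʳ j
↑ˡ≢↑ʳ {m} {n} i j eq
  with () ← trans (sym (splitAt-↑ˡ m i n)) (trans (cong (splitAt m) eq) (splitAt-↑ʳ m n j))

module _ {m n} (U : Fin (m ℕ.+ n) → Bool) where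

  private
    remove-same : ∀ {k k′} {i t : Fin k} {i′ t′ : Fin k′} (b : Bool) → i ≡ t ⇔ i′ ≡ t′ →
                  b ∧ not (does (i ≟ t)) ≡ b ∧ not (does (i′ ≟ t′))
    remove-same b eqv = cong (λ d → b ∧ not d) (does-⇔ eqv (_ ≟ _) (_ ≟ _))

    remove-other : ∀ {k} {i t : Fin k} (b : Bool) → i ≢ t → b ∧ not (does (i ≟ t)) ≡ b
    remove-other b i≢t = trans (cong (λ d → b ∧ not d) (dec-false (_ ≟ _) i≢t)) (Bool.∧-identityʳ b)

  size-removeˡˡ : ∀ i → size (remove U (i ↑ˡ n) ∘ (_↑ˡ n)) ≡ size (remove (U ∘ (_↑ˡ n)) i)
  size-removeˡˡ i = size-cong λ t →
    remove-same (U (t ↑ˡ n)) (mk⇔ (↑ˡ-injective n i t) (cong (_↑ˡ n)))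

  size-removeˡʳ : ∀ i → size (remove U (i ↑ˡ n) ∘ (m ↑ʳ_)) ≡ size (U ∘ (m ↑ʳ_))
  size-removeˡʳ i = size-cong λ t → remove-other (U (m ↑ʳ t)) (↑ˡ≢↑ʳ i t)

  size-removeʳˡ : ∀ i → size (remove U (m ↑ʳ i) ∘ (_↑ˡ n)) ≡ size (U ∘ (_↑ˡ n))
  size-removeʳˡ i = size-cong λ t → remove-other (U (t ↑ˡ n)) (↑ˡ≢↑ʳ t i ∘ sym)

  size-removeʳʳ : ∀ i → size (remove U (m ↑ʳ i) ∘ (m ↑ʳ_)) ≡ size (remove (U ∘ (m ↑ʳ_)) i)
  size-removeʳʳ i = size-cong λ t →
    remove-same (U (m ↑ʳ t)) (mk⇔ (↑ʳ-injective m i t) (cong (m ↑ʳ_)))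

size-↑ : ∀ m {n} (U : Fin (m ℕ.+ n) → Bool) → size U ≡ size (U ∘ (_↑ˡ n)) ℕ.+ size (U ∘ (m ↑ʳ_))
size-↑ zero    U = refl
size-↑ (suc m) U = trans (cong (ℕ._+_ (if U zero then 1 else 0)) (size-↑ m (U ∘ suc)))
                         (sym (ℕ.+-assoc (if U zero then 1 else 0) _ _))

module _ (c a : ℕ) where

  -- A word of `r` arc letters is a word of `r` arc classes together with one of `2 ^ r` choices of
  -- orientation.
  arcWords : ℕ → ℕ → ℤ
  arcWords w r = + (2 ^ r) * hit r a w

  diagonalWords : ℕ → ℕ → ℤ
  diagonalWords v s = hit s c v

  arcWords-remove : ∀ (W : Fin a → Bool) r →
    sum (λ i → arcWords (size (remove W i)) r) ≡ + (2 ^ r) * hit (suc r) a (size W)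
  arcWords-remove W r = trans
    (sym (*-distribˡ-sum (+ (2 ^ r)) λ i → hit r a (size (remove W i))))
    (cong (_*_ (+ (2 ^ r))) (hit-remove r W))

  -- Induction on the length for all `U` at once. A diagonal first letter shifts the sequence of
  -- diagonal words, an arc letter that of arc words, and these are the two halves of the recursion
  -- of `conv`.
  covering-fold : ∀ m (U : Fin (c ℕ.+ a) → Bool) →
    + covering (fold c a) m U ≡
    conv m (arcWords (size (U ∘ (c ↑ʳ_)))) (diagonalWords (size (U ∘ (_↑ˡ a))))
  -- The empty word covers only the empty set, and `hit 0` vanishes as soon as one block contains a
  -- required class.
  covering-fold zero U with size (U ∘ (_↑ˡ a)) in eqV | size (U ∘ (c ↑ʳ_)) in eqW
  ... | zero  | zero  = (covering-zero-full (fold c a) U (trans (size-↑ c U) (cong₂ ℕ._+_ eqV eqW)))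
  ... | suc v | w     = trans
    ((covering-zero-empty (fold c a) U (trans (size-↑ c U) (cong₂ ℕ._+_ eqV eqW))))
    (sym (trans (cong (_*_ (arcWords w 0)) (hit-zero c v)) (ℤ.*-zeroʳ (arcWords w 0))))
  ... | zero  | suc w = trans
    ((covering-zero-empty (fold c a) U (trans (size-↑ c U) (cong₂ ℕ._+_ eqV eqW))))
    (sym (cong (λ h → 1ℤ * h * hit 0 c 0) (hit-zero a w)))
  covering-fold (suc m) U = begin
    + covering κ (suc m) U
      ≡⟨ covering-suc κ m U ⟩
    sum (λ l → f (κ l))
      ≡⟨ trans (sum-↑ c (f ∘ κ))
               (cong (_+_ (sum (λ (i : Fin c) → f (κ (i ↑ˡ a ℕ.+ a)))))
                     (sum-↑ a (λ j → f (κ (c ↑ʳ j))))) ⟩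
    sum (λ (i : Fin c) → f (κ (i ↑ˡ a ℕ.+ a))) +
      (sum (λ i → f (κ (c ↑ʳ (i ↑ˡ a)))) + sum (λ i → f (κ (c ↑ʳ (a ↑ʳ i)))))
      ≡⟨ cong₂ _+_ (sum-cong-≗ (λ i → cong f (fold-diagonal c a i)))
           (cong₂ _+_ (sum-cong-≗ (λ i → cong f (fold-arc c a i)))
                      (sum-cong-≗ (λ i → cong f (fold-reversed c a i)))) ⟩
    sum (λ i → f (i ↑ˡ a)) + (sum (λ i → f (c ↑ʳ i)) + sum (λ i → f (c ↑ʳ i)))
      ≡⟨ cong₂ (λ x y → x + (y + y)) diagonalPart arcPart ⟩
    conv m x (y ∘ suc) + (conv m z y + conv m z y)
      -- Every arc class occurs once per orientation; `double` absorbs the factor 2 into `2 ^ suc r`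
      -- and so produces the shifted `x`.
      ≡⟨ cong (_+_ (conv m x (y ∘ suc))) (sym (conv-+ˡ m z z y)) ⟩
    conv m x (y ∘ suc) + conv m (λ r → z r + z r) y
      ≡⟨ cong (_+_ (conv m x (y ∘ suc))) (conv-cong m {y = y} double (λ _ → refl)) ⟩
    conv m x (y ∘ suc) + conv m (x ∘ suc) y
      ≡⟨ ℤ.+-comm (conv m x (y ∘ suc)) _ ⟩
    conv (suc m) x y ∎
    where
    κ = fold c a
    V = U ∘ (_↑ˡ a)
    W = U ∘ (c ↑ʳ_)
    x = arcWords (size W)
    y = diagonalWords (size V)
    z : ℕ → ℤ
    z r = + (2 ^ r) * hit (suc r) a (size W)
    f : Fin (c ℕ.+ a) → ℤ
    f t = + covering κ m (remove U t)
    double : ∀ r → z r + z r ≡ x (suc r)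
    double r = trans (2*-distrib (+ (2 ^ r)) (hit (suc r) a (size W)))
                     (cong (λ k → k * hit (suc r) a (size W)) (sym (ℤ.pos-* 2 (2 ^ r))))
      where
      2*-distrib : ∀ p h → p * h + p * h ≡ + 2 * p * h
      2*-distrib = solve-∀
    diagonalPart : sum (λ i → f (i ↑ˡ a)) ≡ conv m x (y ∘ suc)
    diagonalPart = begin
      sum (λ i → f (i ↑ˡ a))
        ≡⟨ sum-cong-≗ (λ i → trans (covering-fold m (remove U (i ↑ˡ a)))
             (cong₂ (λ w v → conv m (arcWords w) (diagonalWords v))
                    (size-removeˡʳ U i) (size-removeˡˡ U i))) ⟩
      sum (λ i → conv m x (diagonalWords (size (remove V i))))
        ≡⟨ conv-sumʳ m x (λ i → diagonalWords (size (remove V i))) ⟩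
      conv m x (λ s → sum λ i → diagonalWords (size (remove V i)) s)
        ≡⟨ conv-cong m {x = x} (λ _ → refl) (λ s → hit-remove s V) ⟩
      conv m x (y ∘ suc) ∎
    arcPart : sum (λ i → f (c ↑ʳ i)) ≡ conv m z y
    arcPart = begin
      sum (λ i → f (c ↑ʳ i))
        ≡⟨ sum-cong-≗ (λ i → trans (covering-fold m (remove U (c ↑ʳ i)))
             (cong₂ (λ w v → conv m (arcWords w) (diagonalWords v))
                    (size-removeʳʳ {c} U i) (size-removeʳˡ U i))) ⟩
      sum (λ i → conv m (arcWords (size (remove W i))) y)
        ≡⟨ conv-sumˡ m (λ i → arcWords (size (remove W i))) y ⟩
      conv m (λ r → sum λ i → arcWords (size (remove W i)) r) y
        ≡⟨ conv-cong m {y = y} (arcWords-remove W) (λ _ → refl) ⟩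
      conv m z y ∎

-- Operations as words

↑-cover : ∀ m {n} (i : Fin (m ℕ.+ n)) → (∃ λ j → j ↑ˡ n ≡ i) ⊎ (∃ λ j → m ↑ʳ j ≡ i)
↑-cover m i with splitAt m i in eq
... | inj₁ j = inj₁ (j , splitAt⁻¹-↑ˡ eq)
... | inj₂ j = inj₂ (j , splitAt⁻¹-↑ʳ eq)

-- This is `n C 2` with a recursion that separates the pairs `i < j` with `i = 0` from the others,
-- so that `pair` and `glue` can follow it.
tri : ℕ → ℕ
tri zero    = 0
tri (suc n) = n ℕ.+ tri n

tri≡nC2 : ∀ n → tri n ≡ n C 2
tri≡nC2 zero    = refl
tri≡nC2 (suc n) = trans (cong₂ ℕ._+_ (sym (nC1≡n n)) (tri≡nC2 n)) (nCk+nC[k+1]≡[n+1]C[k+1] n 1)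

pair : ∀ n → Fin (tri n) → Fin n × Fin n
pair (suc n) k = [ (λ j → zero , suc j) , Product.map suc suc ∘ pair n ]′ (splitAt n k)

pair-cover : ∀ {n} (i j : Fin n) →
             i ≡ j ⊎ (∃ λ k → pair n k ≡ (i , j)) ⊎ (∃ λ k → pair n k ≡ (j , i))
pair-cover {suc n} zero zero = inj₁ refl
pair-cover {suc n} zero (suc j) =
  inj₂ (inj₁ (j ↑ˡ tri n , cong [ _ , _ ]′ (splitAt-↑ˡ n j (tri n))))
pair-cover {suc n} (suc i) zero =
  inj₂ (inj₂ (i ↑ˡ tri n , cong [ _ , _ ]′ (splitAt-↑ˡ n i (tri n))))
pair-cover {suc n} (suc i) (suc j) with pair-cover i j
... | inj₁ refl = inj₁ refl
... | inj₂ (inj₁ (k , eq)) = inj₂ (inj₁ (n ↑ʳ k ,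
  trans (cong [ _ , _ ]′ (splitAt-↑ʳ n (tri n) k)) (cong (Product.map suc suc) eq)))
... | inj₂ (inj₂ (k , eq)) = inj₂ (inj₂ (n ↑ʳ k ,
  trans (cong [ _ , _ ]′ (splitAt-↑ʳ n (tri n) k)) (cong (Product.map suc suc) eq)))

-- An operation on Fin n is its diagonal together with, for each i < j, the pair
-- of its values at (i , j) and (j , i).

glue : ∀ n → (Fin n → A) → (Fin (tri n) → A × A) → Fin n → Fin n → A
glue (suc n) h g zero    zero    = h zero
glue (suc n) h g zero    (suc j) = proj₁ (g (j ↑ˡ tri n))
glue (suc n) h g (suc i) zero    = proj₂ (g (i ↑ˡ tri n))
glue (suc n) h g (suc i) (suc j) = glue n (h ∘ suc) (g ∘ (n ↑ʳ_)) i j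

glue-diagonal : ∀ n (h : Fin n → A) g i → glue n h g i i ≡ h i
glue-diagonal (suc n) h g zero    = refl
glue-diagonal (suc n) h g (suc i) = glue-diagonal n (h ∘ suc) (g ∘ (n ↑ʳ_)) i

glue-pair : ∀ n (h : Fin n → A) g k →
            let i , j = pair n k in (glue n h g i j , glue n h g j i) ≡ g k
glue-pair (suc n) h g k with splitAt n k in eq
... | inj₁ j  = cong g (splitAt⁻¹-↑ˡ eq)
... | inj₂ k′ = trans (glue-pair n (h ∘ suc) (g ∘ (n ↑ʳ_)) k′) (cong g (splitAt⁻¹-↑ʳ eq))

-- Enumerations from cardinalities

module Enumeration {A : Set s} {P : Pred A p} {k} (card : HasCardinality (setoid A) P k) where
  open Inverse card

  enum : Fin k → A
  enum i = proj₁ (from i)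

  enum-∈ : ∀ i → P (enum i)
  enum-∈ i = proj₂ (from i)

  enum-index : ∀ {x} → P x → ∃ λ i → enum i ≡ x
  enum-index {x} px = to (x , px) , strictlyInverseʳ (x , px)

  enum-injective : ∀ {i j} → enum i ≡ enum j → i ≡ j
  enum-injective eq = trans (sym (strictlyInverseˡ _)) (trans (to-cong eq) (strictlyInverseˡ _))

  -- A cardinality already makes membership decidable: the finite enumeration can be searched.
  enum? : DecidableEquality A → Decidable P
  enum? _≟ᴬ_ x = map′ (λ (i , eq) → subst P eq (enum-∈ i)) enum-index (any? λ i → enum i ≟ᴬ x)

HasCardinality-unique : ∀ {S : Setoid s e} {P : Pred (Setoid.Carrier S) p} {k l} →
                        HasCardinality S P k → HasCardinality S P l → k ≡ l
HasCardinality-unique k-card l-card = ↔⇒≡ (Composition.inverse (Symmetry.inverse k-card) l-card)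

functions : ∀ m k → Inverse (Fin m →-setoid Fin k) (setoid (Fin (k ^ m)))
functions m k = record
  { to        = funToFin
  ; from      = finToFun
  ; to-cong   = funToFin-cong
  ; from-cong = λ { refl _ → refl }
  ; inverse   =
      (λ f≗ → trans (funToFin-cong f≗) (funToFin-finToFin {m} {k} _))
    , (λ { refl → finToFun-funToFin _ })
  }
  where
  funToFin-cong : ∀ {m k} {f g : Fin m → Fin k} → f ≗ g → funToFin f ≡ funToFin g
  funToFin-cong {zero}  f≗g = refl
  funToFin-cong {suc m} f≗g = cong₂ combine (f≗g zero) (funToFin-cong (f≗g ∘ suc))

-- Left divisibility and images of `T`

module _ {X : Set ℓ} where

  diag⇒Δ : ∀ {∗ : Op₂ X} → diag ∗ ⊆ Δ
  diag⇒Δ (_ , refl , refl) = refl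

  diag⊆im : ∀ {∗ : Op₂ X} → diag ∗ ⊆ im ∗
  diag⊆im (x , _ , eq) = x , eq

  im-swap : ∀ {∗ : Op₂ X} {q} → q ∈ im ∗ → swap q ∈ im ∗
  im-swap (x , eq) = swap x , cong swap eq

  T-Δ : ∀ {∗ : Op₂ X} {q} → q ∈ Δ → T ∗ q ∈ Δ
  T-Δ refl = refl

  -- For finite `X` this amounts to `∗` being `y ▷ ⋆` for some `y`. The clause on `diag` is there
  -- because `T y` maps diagonal pairs to diagonal pairs.
  _≲_ : Op₂ X → Op₂ X → Set ℓ
  ∗ ≲ ⋆ = (diag ∗ ⊆ diag ⋆) × (im ∗ ⊆ im ⋆)

  LeftIdeal⇒≲ : ∀ {∗ ⋆} → LeftIdeal (𝓜 X) ⋆ ∗ → ∗ ≲ ⋆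
  LeftIdeal⇒≲ {∗} {⋆} (y , ∗≈y▷⋆) =
    (λ { ((a , b) , a≡b , refl) → T y (a , b) , T-Δ {y} a≡b , sym (factor (a , b)) }) ,
    (λ { (x , refl) → T y x , sym (factor x) })
    where
    factor : ∀ q → T ∗ q ≡ T ⋆ (T y q)
    factor (a , b) = cong₂ _,_ (∗≈y▷⋆ a b) (∗≈y▷⋆ b a)

  LClass⇒≲ : ∀ {∗ ⋆} → LClass (𝓜 X) ∗ ⋆ → ∗ ≲ ⋆ × ⋆ ≲ ∗
  LClass⇒≲ {∗} {⋆} (∗⊆⋆ , ⋆⊆∗) =
    -- `lz` is the identity, so each operation lies in its own left ideal.
    LeftIdeal⇒≲ {∗} {⋆} (∗⊆⋆ (lz , λ _ _ → refl)) , LeftIdeal⇒≲ {⋆} {∗} (⋆⊆∗ (lz , λ _ _ → refl))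

  module _ {p} (ω : Tournament X p) (∗ : Op₂ X) where
    open Tournament ω

    accok-arc : ∀ (x : ∃ λ q → q ∈ acdom ∗ × q ∈ arcs) → T ∗ (proj₁ x) ∈ arcs →
                proj₁ (accok ω ∗ x) ≡ T ∗ (proj₁ x)
    accok-arc (_ , ac , _) arc with exactlyOne ac
    ... | inj₁ _         = refl
    ... | inj₂ (_ , ¬arc) = contradiction arc ¬arc

    accok-reversed : ∀ (x : ∃ λ q → q ∈ acdom ∗ × q ∈ arcs) → swap (T ∗ (proj₁ x)) ∈ arcs →
                     proj₁ (accok ω ∗ x) ≡ swap (T ∗ (proj₁ x))
    accok-reversed (_ , ac , _) arc with exactlyOne ac
    ... | inj₁ (_ , ¬arc) = contradiction arc ¬arc
    ... | inj₂ _          = refl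

    acim⇒im : acim ω ∗ ⊆ im ∗
    acim⇒im (((a , b) , ac , _) , eq) with exactlyOne ac
    ... | inj₁ _ = (a , b) , eq
    ... | inj₂ _ = (b , a) , eq

    acim⇒arcs : acim ω ∗ ⊆ arcs
    acim⇒arcs (x , refl) = proj₂ (accok ω ∗ x)

    -- With the two inclusions above, `acim` is `im ∗` restricted to the arcs. If `(x , y)` is not
    -- an arc, then `(y , x)` is one; `T ∗` sends it to the reversal of `q`, which `accok` turns
    -- back.
    im∩arcs⇒acim : ∀ {q} → q ∈ im ∗ → q ∈ arcs → q ∈ acim ω ∗
    im∩arcs⇒acim ((x , y) , refl) arc with exactlyOne {x} {y} (offDiagonal arc ∘ T-Δ {∗} {x , y})
    ... | inj₁ (xy , _) =
      ((x , y) , offDiagonal arc , xy) , accok-arc ((x , y) , offDiagonal arc , xy) arc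
    ... | inj₂ (yx , _) =
      ((y , x) , offDiagonal arc ∘ sym , yx) ,
      accok-reversed ((y , x) , offDiagonal arc ∘ sym , yx) arc

-- Lifting on a finite set

module Finite {n} {X : Set ℓ} (X↔Fin : X ↔ Fin n) where
  open Inverse X↔Fin

  point : Fin n → X × X
  point i = from i , from i

  edge : Fin (tri n) → X × X
  edge k = Product.map from from (pair n k)

  operation : (Fin n → X) → (Fin (tri n) → X × X) → Op₂ X
  operation h g x y = glue n h g (to x) (to y)

  T-operation-point : ∀ h g i → T (operation h g) (point i) ≡ (h i , h i)
  T-operation-point h g i rewrite strictlyInverseˡ i =
    cong₂ _,_ (glue-diagonal n h g i) (glue-diagonal n h g i)

  T-operation-edge : ∀ h g k → T (operation h g) (edge k) ≡ g k
  T-operation-edge h g k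
    rewrite strictlyInverseˡ (proj₁ (pair n k)) | strictlyInverseˡ (proj₂ (pair n k)) =
    glue-pair n h g k

  -- Points and edges represent the orbits of `swap`. As `T ∗` commutes with `swap`, its values on
  -- them determine it.
  cover : ∀ q → (∃ λ i → q ≡ point i) ⊎ (∃ λ k → q ≡ edge k) ⊎ (∃ λ k → q ≡ swap (edge k))
  cover (x , y) with pair-cover (to x) (to y)
  ... | inj₁ eq = inj₁ (to x ,
    cong₂ _,_ (sym (strictlyInverseʳ x)) (trans (sym (strictlyInverseʳ y)) (cong from (sym eq))))
  ... | inj₂ (inj₁ (k , eq)) = inj₂ (inj₁ (k ,
    trans (cong₂ _,_ (sym (strictlyInverseʳ x)) (sym (strictlyInverseʳ y)))
          (cong (Product.map from from) (sym eq))))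
  ... | inj₂ (inj₂ (k , eq)) = inj₂ (inj₂ (k ,
    trans (cong₂ _,_ (sym (strictlyInverseʳ x)) (sym (strictlyInverseʳ y)))
          (cong (swap ∘ Product.map from from) (sym eq))))

  Δ-point : ∀ {q} → q ∈ Δ → ∃ λ i → q ≡ point i
  Δ-point {x , _} refl = to x , cong₂ _,_ (sym (strictlyInverseʳ x)) (sym (strictlyInverseʳ x))

  T-ext : ∀ {∗ ⋆ : Op₂ X} → (∀ i → T ∗ (point i) ≡ T ⋆ (point i)) →
          (∀ k → T ∗ (edge k) ≡ T ⋆ (edge k)) → ∀ x y → (∗ x y) ≡ (⋆ x y)
  T-ext {∗} {⋆} onPoints onEdges x y = cong proj₁ (go (cover (x , y)))
    where
    go : ∀ {q} → (∃ λ i → q ≡ point i) ⊎ (∃ λ k → q ≡ edge k) ⊎ (∃ λ k → q ≡ swap (edge k)) →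
         T ∗ q ≡ T ⋆ q
    go (inj₁ (i , refl))        = onPoints i
    go (inj₂ (inj₁ (k , refl))) = onEdges k
    go (inj₂ (inj₂ (k , refl))) = cong swap (onEdges k)

  -- `T y` has to lift `T ∗` through `T ⋆`: on an edge by any preimage, on a point by a diagonal
  -- preimage, which the inclusion of `diag` provides.
  ≲⇒LeftIdeal : ∀ {∗ ⋆ : Op₂ X} → ∗ ≲ ⋆ → LeftIdeal (𝓜 X) ⋆ ∗
  ≲⇒LeftIdeal {∗} {⋆} (diag⊆ , im⊆) = y , T-ext {∗} {y ▷ ⋆} onPoints onEdges
    where
    onDiagonal : ∀ i → T ∗ (point i) ∈ diag ⋆
    onDiagonal i = diag⊆ (point i , refl , refl)
    onEdge : ∀ k → T ∗ (edge k) ∈ im ⋆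
    onEdge k = im⊆ (edge k , refl)
    -- A diagonal preimage is kept as its first coordinate; `q∈Δ` restores the second.
    h = λ i → proj₁ (proj₁ (onDiagonal i))
    g = λ k → proj₁ (onEdge k)
    y = operation h g
    onPoints : ∀ i → T ∗ (point i) ≡ T ⋆ (T y (point i))
    onPoints i with _ , q∈Δ , eq ← onDiagonal i in preimage = begin
      T ∗ (point i)     ≡⟨ eq ⟨
      T ⋆ _             ≡⟨ cong (T ⋆) (cong₂ _,_ refl (sym q∈Δ)) ⟩
      T ⋆ _             ≡⟨ cong (λ z → T ⋆ (proj₁ (proj₁ z) , proj₁ (proj₁ z))) preimage ⟨
      T ⋆ (h i , h i)   ≡⟨ cong (T ⋆) (T-operation-point h g i) ⟨
      T ⋆ (T y (point i)) ∎
    onEdges : ∀ k → T ∗ (edge k) ≡ T ⋆ (T y (edge k))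
    onEdges k = trans (sym (proj₂ (onEdge k))) (cong (T ⋆) (sym (T-operation-edge h g k)))

  ≲⇒LClass : ∀ {∗ ⋆ : Op₂ X} → ∗ ≲ ⋆ → ⋆ ≲ ∗ → LClass (𝓜 X) ∗ ⋆
  ≲⇒LClass {∗} {⋆} ∗≲⋆ ⋆≲∗ =
    absorb {∗} {⋆} (≲⇒LeftIdeal {∗} {⋆} ∗≲⋆) , absorb {⋆} {∗} (≲⇒LeftIdeal {⋆} {∗} ⋆≲∗)
    where
    absorb : ∀ {∗ ⋆ : Op₂ X} → LeftIdeal (𝓜 X) ⋆ ∗ → LeftIdeal (𝓜 X) ∗ ⊆ LeftIdeal (𝓜 X) ⋆
    absorb {∗} {⋆} (y , ∗≈y▷⋆) (w , z≈w▷∗) =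
      (w ▷ y) , λ a b → trans (z≈w▷∗ a b) (∗≈y▷⋆ _ _)

  _≟ˣ_ : DecidableEquality (X × X)
  _≟ˣ_ = ≡-dec (via-injection (↔⇒↣ X↔Fin) _≟_) (via-injection (↔⇒↣ X↔Fin) _≟_)

  -- The alphabet of `∗`

  module _ {p} (ω : Tournament X p) (∗ : Op₂ X) {d c a}
           (drank : HasDrank ∗ d) (crank : HasCrank ∗ c) (arank : HasArank ω ∗ a) where
    open Tournament ω
    module D = Enumeration drank
    module C = Enumeration crank
    module A = Enumeration arank

    diag? : Decidable (diag ∗)
    diag? = D.enum? _≟ˣ_

    arc-off : ∀ i → A.enum i ∉ Δ
    arc-off i = offDiagonal (acim⇒arcs ω ∗ (A.enum-∈ i))

    arc-antisym : ∀ {q} → q ∈ arcs → swap q ∉ arcs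
    arc-antisym arc arc′ with exactlyOne (offDiagonal arc)
    ... | inj₁ (_ , ¬arc′) = ¬arc′ arc′
    ... | inj₂ (_ , ¬arc)  = ¬arc arc

    Letter : Set
    Letter = Fin (c ℕ.+ (a ℕ.+ a))

    letter : Letter → X × X
    letter l = [ C.enum , (λ j → [ A.enum , swap ∘ A.enum ]′ (splitAt a j)) ]′ (splitAt c l)

    diagonal-letter : ∀ i → letter (i ↑ˡ (a ℕ.+ a)) ≡ C.enum i
    diagonal-letter i rewrite splitAt-↑ˡ c i (a ℕ.+ a) = refl

    arc-letter : ∀ i → letter (c ↑ʳ (i ↑ˡ a)) ≡ A.enum i
    arc-letter i rewrite splitAt-↑ʳ c (a ℕ.+ a) (i ↑ˡ a) | splitAt-↑ˡ a i a = refl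

    reversed-letter : ∀ i → letter (c ↑ʳ (a ↑ʳ i)) ≡ swap (A.enum i)
    reversed-letter i rewrite splitAt-↑ʳ c (a ℕ.+ a) (a ↑ʳ i) | splitAt-↑ʳ a a i = refl

    data LetterView : Letter → Set where
      diagonal : ∀ (i : Fin c) → LetterView (i ↑ˡ (a ℕ.+ a))
      arc      : ∀ i → LetterView (c ↑ʳ (i ↑ˡ a))
      reversed : ∀ i → LetterView (c ↑ʳ (a ↑ʳ i))

    letterView : ∀ l → LetterView l
    letterView l with ↑-cover c l
    ... | inj₁ (i , refl) = diagonal i
    ... | inj₂ (j , refl) with ↑-cover a j
    ...   | inj₁ (i , refl) = arc i
    ...   | inj₂ (i , refl) = reversed i

    letter-im : ∀ l → letter l ∈ im ∗
    letter-im l with letterView l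
    ... | diagonal i rewrite diagonal-letter i = proj₁ (C.enum-∈ i)
    ... | arc i      rewrite arc-letter i      = acim⇒im ω ∗ (A.enum-∈ i)
    ... | reversed i rewrite reversed-letter i = im-swap {∗ = ∗} (acim⇒im ω ∗ (A.enum-∈ i))

    C≢A : ∀ i j → C.enum i ≢ A.enum j
    C≢A i j eq = arc-off j (subst Δ eq (proj₂ (C.enum-∈ i)))

    C≢swapA : ∀ i j → C.enum i ≢ swap (A.enum j)
    C≢swapA i j eq = arc-off j (sym (subst Δ eq (proj₂ (C.enum-∈ i))))

    A≢swapA : ∀ i j → A.enum i ≢ swap (A.enum j)
    A≢swapA i j eq = arc-antisym (acim⇒arcs ω ∗ (A.enum-∈ j))
                                   (subst arcs eq (acim⇒arcs ω ∗ (A.enum-∈ i)))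

    -- The three kinds of letters never meet: `cim ∗` lies on the diagonal, arcs lie off it, and a
    -- tournament contains no arc together with its reversal. With `im-letter`, the letters
    -- enumerate `im ∗` exactly once.
    letter-injective : ∀ l l′ → letter l ≡ letter l′ → l ≡ l′
    letter-injective l l′ eq with letterView l | letterView l′
    ... | diagonal i | diagonal j rewrite diagonal-letter i | diagonal-letter j =
      cong (_↑ˡ (a ℕ.+ a)) (C.enum-injective eq)
    ... | diagonal i | arc j      rewrite diagonal-letter i | arc-letter j =
      contradiction eq (C≢A i j)
    ... | diagonal i | reversed j rewrite diagonal-letter i | reversed-letter j =
      contradiction eq (C≢swapA i j)
    ... | arc i      | diagonal j rewrite arc-letter i | diagonal-letter j =
      contradiction (sym eq) (C≢A j i)
    ... | arc i      | arc j      rewrite arc-letter i | arc-letter j =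
      cong (λ k → c ↑ʳ (k ↑ˡ a)) (A.enum-injective eq)
    ... | arc i      | reversed j rewrite arc-letter i | reversed-letter j =
      contradiction eq (A≢swapA i j)
    ... | reversed i | diagonal j rewrite reversed-letter i | diagonal-letter j =
      contradiction (sym eq) (C≢swapA j i)
    ... | reversed i | arc j      rewrite reversed-letter i | arc-letter j =
      contradiction (sym eq) (A≢swapA j i)
    ... | reversed i | reversed j rewrite reversed-letter i | reversed-letter j =
      cong (λ k → c ↑ʳ (a ↑ʳ k)) (A.enum-injective (cong swap eq))

    im-letter : ∀ q → q ∈ im ∗ → ∃ λ l → letter l ≡ q
    im-letter q q∈im with via-injection (↔⇒↣ X↔Fin) _≟_ (proj₁ q) (proj₂ q)
    ... | yes q∈Δ with i , eq ← C.enum-index (q∈im , q∈Δ) = i ↑ˡ _ , trans (diagonal-letter i) eq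
    ... | no  q∉Δ with exactlyOne q∉Δ
    ...   | inj₁ (here , _) with i , eq ← A.enum-index (im∩arcs⇒acim ω ∗ q∈im here) =
            c ↑ʳ (i ↑ˡ a) , trans (arc-letter i) eq
    ...   | inj₂ (there , _)
            with i , eq ← A.enum-index (im∩arcs⇒acim ω ∗ (im-swap {∗ = ∗} q∈im) there) =
            c ↑ʳ (a ↑ʳ i) , trans (reversed-letter i) (cong swap eq)

    -- Hitting a class in the wrong orientation is good enough, because images are closed under
    -- `swap`.
    fold-letter : ∀ l l′ → fold c a l ≡ fold c a l′ →
                  letter l ≡ letter l′ ⊎ letter l ≡ swap (letter l′)
    fold-letter l l′ eq with letterView l | letterView l′
    ... | diagonal i | diagonal j rewrite fold-diagonal c a i | fold-diagonal c a j =
      inj₁ (cong (letter ∘ (_↑ˡ _)) (↑ˡ-injective a i j eq))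
    ... | diagonal i | arc j      rewrite fold-diagonal c a i | fold-arc c a j =
      contradiction eq (↑ˡ≢↑ʳ i j)
    ... | diagonal i | reversed j rewrite fold-diagonal c a i | fold-reversed c a j =
      contradiction eq (↑ˡ≢↑ʳ i j)
    ... | arc i      | diagonal j rewrite fold-arc c a i | fold-diagonal c a j =
      contradiction (sym eq) (↑ˡ≢↑ʳ j i)
    ... | reversed i | diagonal j rewrite fold-reversed c a i | fold-diagonal c a j =
      contradiction (sym eq) (↑ˡ≢↑ʳ j i)
    ... | arc i      | arc j      rewrite fold-arc c a i | fold-arc c a j
        | ↑ʳ-injective c i j eq =
      inj₁ refl
    ... | reversed i | reversed j rewrite fold-reversed c a i | fold-reversed c a j
        | ↑ʳ-injective c i j eq =
      inj₁ refl
    ... | arc i      | reversed j rewrite fold-arc c a i | fold-reversed c a j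
        | ↑ʳ-injective c i j eq | arc-letter j | reversed-letter j =
      inj₂ refl
    ... | reversed i | arc j      rewrite fold-reversed c a i | fold-arc c a j
        | ↑ʳ-injective c i j eq | arc-letter j | reversed-letter j =
      inj₂ refl

    -- The classes that the word on the edges has to hit: the diagonal pairs
    -- that no diagonal pair maps to, and all arcs.

    required : Fin (c ℕ.+ a) → Bool
    required t = [ (λ i → not (does (diag? (C.enum i)))) , const true ]′ (splitAt c t)

    required-diagonal : ∀ i → required (i ↑ˡ a) ≡ not (does (diag? (C.enum i)))
    required-diagonal i rewrite splitAt-↑ˡ c i a = refl

    required-arc : ∀ i → required (c ↑ʳ i) ≡ true
    required-arc i rewrite splitAt-↑ʳ c a i = refl

    required⇒∉diag : ∀ i → required (i ↑ˡ a) ≡ true → C.enum i ∉ diag ∗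
    required⇒∉diag i req ∈D
      with () ← trans (sym req) (trans (required-diagonal i)
                                    (cong not (dec-true (diag? (C.enum i)) ∈D)))

    -- Letters in `diag ∗` are supplied by the points, so the word on the edges may omit them; every
    -- other letter has a required class.
    required-fold : ∀ l → letter l ∈ diag ∗ ⊎ required (fold c a l) ≡ true
    required-fold l with letterView l
    ... | diagonal i rewrite diagonal-letter i | fold-diagonal c a i with diag? (C.enum i)
    ...   | yes ∈D = inj₁ ∈D
    ...   | no  ∉D = inj₂ (trans (required-diagonal i) (cong not (dec-false (diag? (C.enum i)) ∉D)))
    required-fold l | arc i      = inj₂ (trans (cong required (fold-arc c a i)) (required-arc i))
    required-fold l | reversed i =
      inj₂ (trans (cong required (fold-reversed c a i)) (required-arc i))

    -- `diag ∗` is contained in `cim ∗`, so its `d` elements all occur among the `c` diagonal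
    -- letters.
    d-card : HasCardinality (setoid (Fin c)) (λ i → C.enum i ∈ diag ∗) d
    d-card = record
      { to        = λ (_ , ∈D) → proj₁ (D.enum-index ∈D)
      ; from      = λ t → proj₁ (inC t) , subst (_∈ diag ∗) (sym (proj₂ (inC t))) (D.enum-∈ t)
      ; to-cong   = λ { {_ , ∈D} {_ , ∈D′} refl → D.enum-injective
          (trans (proj₂ (D.enum-index ∈D)) (sym (proj₂ (D.enum-index ∈D′)))) }
      ; from-cong = λ { refl → refl }
      ; inverse   =
          (λ { {t} {_ , ∈D} refl → D.enum-injective
              (trans (proj₂ (D.enum-index ∈D)) (proj₂ (inC t))) })
        , (λ { {_ , ∈D} refl → C.enum-injective (trans (proj₂ (inC _)) (proj₂ (D.enum-index ∈D))) })
      }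
      where
      inC : ∀ t → ∃ λ i → C.enum i ≡ D.enum t
      inC t = C.enum-index (diag⊆im {∗ = ∗} (D.enum-∈ t) , diag⇒Δ {∗ = ∗} (D.enum-∈ t))

    -- The additive form also yields `d ≤ c`, which the final count uses.
    size-required : d ℕ.+ size (required ∘ (_↑ˡ a)) ≡ c
    size-required = begin
      d ℕ.+ size (required ∘ (_↑ˡ a))
        ≡⟨ cong₂ ℕ._+_ (HasCardinality-unique d-card
                         (count-card (setoid (Fin c)) (λ { refl → id }) (Identity.inverse _) inD?))
                       (size-cong required-diagonal) ⟩
      count inD? ℕ.+ size (not ∘ does ∘ inD?)
        ≡⟨ cong (ℕ._+ size (not ∘ does ∘ inD?)) (size-count inD?) ⟩
      size (does ∘ inD?) ℕ.+ size (not ∘ does ∘ inD?)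
        ≡⟨ size-complement (does ∘ inD?) ⟩
      c ∎
      where
      inD? : Decidable (λ i → C.enum i ∈ diag ∗)
      inD? = diag? ∘ C.enum

    -- Words encoding the members of the 𝓛-class

    record Encodes (⋆ : Op₂ X) (h : Fin n → Fin d) (g : Fin (tri n) → Letter) : Set ℓ where
      field
        onPoints : ∀ i → T ⋆ (point i) ≡ D.enum (h i)
        onEdges  : ∀ k → T ⋆ (edge k) ≡ letter (g k)

    decode : (Fin n → Fin d) → (Fin (tri n) → Letter) → Op₂ X
    decode h g = operation (proj₁ ∘ D.enum ∘ h) (letter ∘ g)

    decode-encodes : ∀ h g → Encodes (decode h g) h g
    decode-encodes h g = record
      { onPoints = λ i → trans (T-operation-point _ _ i)
          (cong (proj₁ (D.enum (h i)) ,_) (diag⇒Δ {∗ = ∗} (D.enum-∈ (h i))))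
      ; onEdges  = T-operation-edge _ _
      }

    module _ {⋆ h g} (enc : Encodes ⋆ h g) where
      open Encodes enc

      -- All values come from `diag ∗` and `im ∗`. What remains for the 𝓛-class is `∗ ≲ ⋆`, and
      -- surjectivity of `h` with covering by `g` expresses exactly that.
      encoded-≲ : ⋆ ≲ ∗
      encoded-≲ = diag⊆ , im⊆
        where
        onPoint : ∀ i → T ⋆ (point i) ∈ diag ∗
        onPoint i = subst (_∈ diag ∗) (sym (onPoints i)) (D.enum-∈ (h i))
        onEdge : ∀ k → T ⋆ (edge k) ∈ im ∗
        onEdge k = subst (_∈ im ∗) (sym (onEdges k)) (letter-im (g k))
        diag⊆ : diag ⋆ ⊆ diag ∗
        diag⊆ (q , q∈Δ , refl) with i , refl ← Δ-point q∈Δ = onPoint i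
        im⊆ : im ⋆ ⊆ im ∗
        im⊆ (q , refl) with cover q
        ... | inj₁ (i , refl)        = diag⊆im {∗ = ∗} (onPoint i)
        ... | inj₂ (inj₁ (k , refl)) = onEdge k
        ... | inj₂ (inj₂ (k , refl)) = im-swap {∗ = ∗} (onEdge k)

      LClass⇒surjective : LClass (𝓜 X) ∗ ⋆ → StrictlySurjective _≡_ h
      LClass⇒surjective L t with q , q∈Δ , eq ← proj₁ (proj₁ (LClass⇒≲ {∗ = ∗} {⋆} L)) (D.enum-∈ t)
                            with i , refl ← Δ-point q∈Δ =
        i , D.enum-injective (trans (sym (onPoints i)) eq)

      -- Points go to `diag ∗`, which contains neither a required diagonal pair nor an arc. A
      -- required class is therefore hit at an edge, possibly a reversed one.
      LClass⇒covers : LClass (𝓜 X) ∗ ⋆ → Covers (fold c a) required g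
      LClass⇒covers L t req with ↑-cover c t
      ... | inj₁ (i , refl) = hitDiagonal (proj₂ ∗≲⋆ (proj₁ (C.enum-∈ i)))
        where
        ∗≲⋆ = proj₁ (LClass⇒≲ {∗ = ∗} {⋆} L)
        hitBy : ∀ k → letter (g k) ≡ C.enum i → fold c a (g k) ≡ i ↑ˡ a
        hitBy k eq′ = trans (cong (fold c a) (letter-injective (g k) (i ↑ˡ _)
                                               (trans eq′ (sym (diagonal-letter i)))))
                            (fold-diagonal c a i)
        hitDiagonal : C.enum i ∈ im ⋆ → ∃ λ k → fold c a (g k) ≡ i ↑ˡ a
        hitDiagonal (q , eq′) with cover q
        ... | inj₁ (j , refl) =
          contradiction (subst (_∈ diag ∗) (trans (sym (onPoints j)) eq′) (D.enum-∈ (h j)))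
                        (required⇒∉diag i req)
        ... | inj₂ (inj₁ (k , refl)) = k , hitBy k (trans (sym (onEdges k)) eq′)
        -- A reversed edge gives the swapped value, and `swap` fixes a diagonal pair.
        ... | inj₂ (inj₂ (k , refl)) = k , hitBy k (begin
          letter (g k)           ≡⟨ onEdges k ⟨
          T ⋆ (edge k)           ≡⟨ cong swap eq′ ⟩
          swap (C.enum i)        ≡⟨ cong₂ _,_ (sym (proj₂ (C.enum-∈ i))) (proj₂ (C.enum-∈ i)) ⟩
          C.enum i ∎)
      ... | inj₂ (i , refl) =
        hitArc (proj₂ (proj₁ (LClass⇒≲ {∗ = ∗} {⋆} L)) (acim⇒im ω ∗ (A.enum-∈ i)))
        where
        hitArc : A.enum i ∈ im ⋆ → ∃ λ k → fold c a (g k) ≡ c ↑ʳ i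
        hitArc (q , eq′) with cover q
        ... | inj₁ (j , refl) = contradiction (subst Δ eq′ refl) (arc-off i)
        ... | inj₂ (inj₁ (k , refl)) = k , trans
          (cong (fold c a) (letter-injective (g k) _
            (trans (sym (onEdges k)) (trans eq′ (sym (arc-letter i))))))
          (fold-arc c a i)
        ... | inj₂ (inj₂ (k , refl)) = k , trans
          (cong (fold c a) (letter-injective (g k) _
            (trans (sym (onEdges k)) (trans (cong swap eq′) (sym (reversed-letter i))))))
          (fold-reversed c a i)

      -- Surjectivity reaches `diag ∗` at points. Any other element of `im ∗` has a required class,
      -- so an edge or its reversal reaches it.
      covers⇒LClass : StrictlySurjective _≡_ h → Covers (fold c a) required g → LClass (𝓜 X) ∗ ⋆
      covers⇒LClass surj cov = ≲⇒LClass {∗} {⋆} (diag⊆ , im⊆) encoded-≲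
        where
        diag⊆ : diag ∗ ⊆ diag ⋆
        diag⊆ q∈D with t , refl ← D.enum-index q∈D with i , refl ← surj t =
          point i , refl , onPoints i
        onEdge : ∀ k → letter (g k) ∈ im ⋆
        onEdge k = edge k , onEdges k
        im⊆ : im ∗ ⊆ im ⋆
        im⊆ {q} q∈im with l , refl ← im-letter q q∈im with required-fold l
        ... | inj₁ l∈D = diag⊆im {∗ = ⋆} (diag⊆ l∈D)
        ... | inj₂ req with k , eq ← cov (fold c a l) req with fold-letter l (g k) (sym eq)
        ...   | inj₁ same    = subst (_∈ im ⋆) (sym same) (onEdge k)
        ...   | inj₂ swapped = subst (_∈ im ⋆) (sym swapped) (im-swap {∗ = ⋆} (onEdge k))

    -- The size of the 𝓛-class

    surjections : HasCardinality (Fin n →-setoid Fin d) (StrictlySurjective _≡_) (Surj n d)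
    surjections = count-card (Fin n →-setoid Fin d) {StrictlySurjective _≡_}
      (λ f≗g surj y → proj₁ (surj y) , trans (sym (f≗g (proj₁ (surj y)))) (proj₂ (surj y)))
      (functions n d) (λ i → surjective? (finToFun {d} {n} i))

    coverings : HasCardinality (Fin (tri n) →-setoid Letter) (Covers (fold c a) required)
                               (covering (fold c a) (tri n) required)
    coverings = count-card (Fin (tri n) →-setoid Letter) (Covers-resp (fold c a))
      (functions (tri n) _) (λ i → covers? (fold c a) required (finToFun i))

    -- The values at points and at edges are chosen independently, hence the product; `combine` and
    -- `remQuot` pass between pairs of choices and their indices.
    LClass-card : HasCardinality (Monoid.setoid (𝓜 X)) (LClass (𝓜 X) ∗)
                                 (Surj n d ℕ.* covering (fold c a) (tri n) required)
    LClass-card = Symmetry.inverse (Bijection⇒Inverse bijection)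
      where
      module S = Inverse surjections
      module G = Inverse coverings
      r = covering (fold c a) (tri n) required
      split : Fin (Surj n d ℕ.* r) → Fin (Surj n d) × Fin r
      split = remQuot r
      points : Fin (Surj n d ℕ.* r) → Fin n → Fin d
      points i = proj₁ (S.from (proj₁ (split i)))
      edges : Fin (Surj n d ℕ.* r) → Fin (tri n) → Letter
      edges i = proj₁ (G.from (proj₂ (split i)))
      member : Fin (Surj n d ℕ.* r) → ∃ (LClass (𝓜 X) ∗)
      member i = decode (points i) (edges i) ,
        covers⇒LClass (decode-encodes (points i) (edges i))
          (proj₂ (S.from (proj₁ (split i)))) (proj₂ (G.from (proj₂ (split i))))
      injective : ∀ {i j} → (∀ x y → proj₁ (member i) x y ≡ proj₁ (member j) x y) → i ≡ j
      injective {i} {j} eq = begin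
        i                                                  ≡⟨ combine-remQuot {Surj n d} r i ⟨
        combine (proj₁ (split i)) (proj₂ (split i))
          ≡⟨ cong₂ combine (trans (sym (S.strictlyInverseˡ _))
                                  (trans (S.to-cong samePoints) (S.strictlyInverseˡ _)))
                           (trans (sym (G.strictlyInverseˡ _))
                                  (trans (G.to-cong sameEdges) (G.strictlyInverseˡ _))) ⟩
        combine (proj₁ (split j)) (proj₂ (split j))
                                                           ≡⟨ combine-remQuot {Surj n d} r j ⟩
        j ∎
        where
        module Eᵢ = Encodes (decode-encodes (points i) (edges i))
        module Eⱼ = Encodes (decode-encodes (points j) (edges j))
        samePoints : points i ≗ points j
        samePoints k = D.enum-injective
          (trans (sym (Eᵢ.onPoints k)) (trans (cong₂ _,_ (eq _ _) (eq _ _)) (Eⱼ.onPoints k)))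
        sameEdges : edges i ≗ edges j
        sameEdges k = letter-injective _ _
          (trans (sym (Eᵢ.onEdges k)) (trans (cong₂ _,_ (eq _ _) (eq _ _)) (Eⱼ.onEdges k)))
      preimage : ∀ ((⋆ , _) : ∃ (LClass (𝓜 X) ∗)) → ∃ λ i → ∀ x y → proj₁ (member i) x y ≡ ⋆ x y
      preimage (⋆ , L) = i , T-ext
        (λ k → trans (Eᵢ.onPoints k) (trans (cong D.enum (samePoints k))
                                       (sym (Encodes.onPoints enc k))))
        (λ k → trans (Eᵢ.onEdges k) (trans (cong letter (sameEdges k))
                                      (sym (Encodes.onEdges enc k))))
        where
        ⋆≲∗ = proj₂ (LClass⇒≲ {∗ = ∗} {⋆} L)
        onPoint : ∀ k → ∃ λ t → D.enum t ≡ T ⋆ (point k)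
        onPoint k = D.enum-index (proj₁ ⋆≲∗ (point k , refl , refl))
        onEdge : ∀ k → ∃ λ l → letter l ≡ T ⋆ (edge k)
        onEdge k = im-letter _ (proj₂ ⋆≲∗ (edge k , refl))
        enc : Encodes ⋆ (proj₁ ∘ onPoint) (proj₁ ∘ onEdge)
        enc = record { onPoints = sym ∘ proj₂ ∘ onPoint ; onEdges = sym ∘ proj₂ ∘ onEdge }
        h = proj₁ ∘ onPoint , LClass⇒surjective enc L
        g = proj₁ ∘ onEdge , LClass⇒covers enc L
        i = combine (S.to h) (G.to g)
        module Eᵢ = Encodes (decode-encodes (points i) (edges i))
        samePoints : ∀ k → points i k ≡ proj₁ (onPoint k)
        samePoints k = trans (cong (λ z → proj₁ (S.from (proj₁ z)) k)
                                   (remQuot-combine (S.to h) (G.to g)))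
                             (S.strictlyInverseʳ h k)
        sameEdges : ∀ k → edges i k ≡ proj₁ (onEdge k)
        sameEdges k = trans (cong (λ z → proj₁ (G.from (proj₂ z)) k)
                                   (remQuot-combine (S.to h) (G.to g)))
                            (G.strictlyInverseʳ g k)
      bijection : Bijection (setoid _) (subsetSetoid (Monoid.setoid (𝓜 X)) (LClass (𝓜 X) ∗))
      bijection = record
        { to        = member
        ; cong      = λ { refl _ _ → refl }
        ; bijective = injective , λ x → proj₁ (preimage x) , λ { refl → proj₂ (preimage x) }
        }

    size-required-arcs : size (required ∘ (c ↑ʳ_)) ≡ a
    size-required-arcs = trans (size-cong required-arc) (size-full a)

    size-required-diagonal : size (required ∘ (_↑ˡ a)) ≡ c ∸ d
    size-required-diagonal = trans (sym (ℕ.m+n∸m≡n d _)) (cong (_∸ d) size-required)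

    lClassSize-correct : + (Surj n d ℕ.* covering (fold c a) (tri n) required) ≡ lClassSize n d c a
    lClassSize-correct = trans (ℤ.pos-* (Surj n d) _) (cong (_*_ (+ Surj n d)) (begin
      + covering (fold c a) (tri n) required
        ≡⟨ covering-fold c a (tri n) required ⟩
      conv (tri n) (arcWords c a (size (required ∘ (c ↑ʳ_))))
                   (diagonalWords c a (size (required ∘ (_↑ˡ a))))
        ≡⟨ cong₂ (λ w v → conv (tri n) (arcWords c a w) (diagonalWords c a v))
                 size-required-arcs size-required-diagonal ⟩
      conv (tri n) (arcWords c a a) (diagonalWords c a (c ∸ d))
        ≡⟨ cong (λ m → conv m (arcWords c a a) (diagonalWords c a (c ∸ d))) (tri≡nC2 n) ⟩
      conv N (arcWords c a a) (diagonalWords c a (c ∸ d))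
        ≡⟨ conv-hit N a c d (subst (d ≤_) size-required (ℕ.m≤m+n d _)) ⟩
      ∑[ a ⋯ (N ℕ.+ d) ∸ c ] (λ r → + (N C r) * hit r a a * + (2 ^ r) * hit (N ∸ r) c (c ∸ d))
        ≡⟨ sumBelow-cong (suc ((N ℕ.+ d) ∸ c) ∸ a) (λ i _ → term (a ℕ.+ i)) ⟩
      ∑[ a ⋯ (N ℕ.+ d) ∸ c ] (λ r → + (N C r) * + Surj r a * + (2 ^ r) *
        (+ (c ^ (N ∸ r)) +
         ∑[ 1 ⋯ c ∸ d ] λ k → -1ℤ ^ℤ k * + ((c ∸ d) C k) * + ((c ∸ k) ^ (N ∸ r)))) ∎))
      where
      N = n C 2
      term : ∀ r → + (N C r) * hit r a a * + (2 ^ r) * hit (N ∸ r) c (c ∸ d) ≡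
        + (N C r) * + Surj r a * + (2 ^ r) *
        (+ (c ^ (N ∸ r)) +
         ∑[ 1 ⋯ c ∸ d ] λ k → -1ℤ ^ℤ k * + ((c ∸ d) C k) * + ((c ∸ k) ^ (N ∸ r)))
      term r = cong₂ (λ x y → + (N C r) * x * + (2 ^ r) * y)
                     (sym (+Surj r a)) (hit-closed (N ∸ r) c (c ∸ d))

theorem8 : ∀ {ℓ p} (n : ℕ) (X : Set ℓ) → X ↔ Fin n →
    (ω : Tournament X p) (∗ : Op₂ X) (d c a : ℕ) →
    HasDrank ∗ d → HasCrank ∗ c → HasArank ω ∗ a →
    ∃ λ k → HasCardinality (Monoid.setoid (𝓜 X)) (LClass (𝓜 X) ∗) k ×
    + k ≡ lClassSize n d c a
theorem8 n X X↔Fin ω ∗ d c a drank crank arank =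
  _ , LClass-card ω ∗ drank crank arank , lClassSize-correct ω ∗ drank crank arank
  where open Finite X↔Fin
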